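{- Let $A=\{a_k\}_{k\in\mathbb{Z}}$ and $B=\{b_k\}_{k\in\mathbb{Z}}$ be sequences of complex numbers, each being $o(k^{c})$ as $k\to\pm\infty$ for some $c<1$. If $\alpha$ and $\beta$ are positive numbers such that $\alpha\beta=\pi^2$, and $w>0$ with $w\ne n^2\beta$ for every positive integer $n$, then $$\begin{aligned} &\frac{\pi}{2}\cot(\sqrt{w\alpha};A)\coth(\sqrt{w\beta};B)\\ &=\frac{a_0b_0}{2w}+\frac{a_0\beta D^{(B)}(2)-b_0\alpha D^{(A)}(2)}{\pi^2}\\ &\quad+\sum_{n=1}^\infty\left\{\frac{n\alpha\coth(n\alpha;A)}{w+n^2\alpha}b_n+\frac{n\beta\coth(n\beta;B)}{w-n^2\beta}a_n\right\}\\ &\quad+\sum_{n=1}^\infty\frac{a_n\coth(n\beta;B)-b_n\coth(n\alpha;A)}{n}. \end{aligned}$$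
   Context: Growth conditions $a_k=o(k^c)$ are understood with $|k|^c$ for negative $k$. For a sequence $A=\{a_k\}$ (likewise $B=\{b_k\}$): $D^{(A)}(j):=\sum_{k=1}^\infty\frac{a_k}{k^j}$ for $j>1$. The cotangent function with sequence $A$ is defined by $$\pi\cot(\pi s;A):=\frac{a_0}{s}-2s\sum_{k=1}^\infty\frac{a_k}{k^2-s^2},$$ and the hyperbolic cotangent with sequence $A$ by $\coth(s;A):=i\cot(is;A)$.
   Formalization: The two infinite series need not converge separately (e.g. α=β=π, a_0=b_0=0, b_n=1, a_n=√|n|), so the identity is stated for the limit of their partial sums with a common cutoff, and literally whenever both series converge. -}

module Defs where

open import Algebra.Apartness.Bundles using (HeytingField)
import Algebra.Definitions.RawSemiring
open import Algebra.Bundles using (CommutativeRing; Semiring)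
import Algebra.Apartness.Properties.HeytingCommutativeRing
open import Data.Integer.Base as ℤ using (ℤ; ∣_∣)
open import Data.Nat.Base as ℕ using (ℕ; zero; suc; NonZero; _!)
open import Data.Nat.Properties using (_!≢0)
open import Data.Product.Base using (∃-syntax; _×_; _,_; proj₁)
open import Data.Sum.Base using (_⊎_)
open import Level using (_⊔_)
open import Relation.Binary.Core using (Rel)
open import Relation.Binary.Structures using (IsStrictPartialOrder)
open import Relation.Nullary.Negation using (¬_)

-- The real numbers, given by their characterisation as the Archimedean, Cauchy
-- complete ordered field.  The axioms are the constructive ones: "different
-- from" is the apartness _#_ of the Heyting field, which is tight, and x ≤ y
-- stands for ¬ (y < x).
record CompleteOrderedField c ℓ₁ ℓ₂ : Set (Level.suc (c ⊔ ℓ₁ ⊔ ℓ₂)) where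
  field
    heytingField : HeytingField c ℓ₁ ℓ₂

  open HeytingField heytingField public

  infix 4 _<_ _≤_ _⟶ᴿ_
  field
    _<_                  : Rel Carrier ℓ₂
    isStrictPartialOrder : IsStrictPartialOrder _≈_ _<_
    #⇒<⊎>                : ∀ {x y} → x # y → x < y ⊎ y < x
    <⇒#                  : ∀ {x y} → x < y → x # y
    0<1                  : 0# < 1#
    +-monoˡ-<            : ∀ {x y} z → x < y → x + z < y + z
    *-pos                : ∀ {x y} → 0# < x → 0# < y → 0# < x * y

  commutativeRing : CommutativeRing c ℓ₁
  commutativeRing = record { isCommutativeRing = isCommutativeRing }

  open Algebra.Definitions.RawSemiring
         (Semiring.rawSemiring (CommutativeRing.semiring commutativeRing)) public
    using (_^_) renaming (_×_ to _•_)

  fromℕ : ℕ → Carrier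
  fromℕ n = n • 1#

  _≤_ : Rel Carrier ℓ₂
  x ≤ y = ¬ (y < x)

  Within : Carrier → Carrier → Carrier → Set ℓ₂
  Within ε x y = x - y ≤ ε × y - x ≤ ε

  IsCauchy : (ℕ → Carrier) → Set (c ⊔ ℓ₂)
  IsCauchy x = ∀ ε → 0# < ε → ∃[ N ] (∀ m n → N ℕ.≤ m → N ℕ.≤ n → Within ε (x m) (x n))

  _⟶ᴿ_ : (ℕ → Carrier) → Carrier → Set (c ⊔ ℓ₂)
  x ⟶ᴿ L = ∀ ε → 0# < ε → ∃[ N ] (∀ n → N ℕ.≤ n → Within ε (x n) L)

  field
    archimedean : ∀ x → ∃[ n ] x < fromℕ n
    complete    : ∀ x → IsCauchy x → ∃[ L ] x ⟶ᴿ L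

  open IsStrictPartialOrder isStrictPartialOrder public
    using (<-respˡ-≈; <-respʳ-≈)
    renaming (trans to <-trans; irrefl to <-irrefl)

module Analysis {c ℓ₁ ℓ₂} (𝓡 : CompleteOrderedField c ℓ₁ ℓ₂) where

  open CompleteOrderedField 𝓡 public renaming (Carrier to ℝ)

  private
    module HCR = Algebra.Apartness.Properties.HeytingCommutativeRing heytingCommutativeRing

  2# : ℝ
  2# = 1# + 1#

  0<⇒#0 : ∀ {x} → 0# < x → x # 0#
  0<⇒#0 0<x = #-sym (<⇒# 0<x)

  +-pos : ∀ {x y} → 0# < x → 0# < y → 0# < x + y
  +-pos {x} {y} 0<x 0<y = <-trans 0<y (<-respˡ-≈ (+-identityˡ y) (+-monoˡ-< y 0<x))

  0<2 : 0# < 2#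
  0<2 = +-pos 0<1 0<1

  0<fromℕ : ∀ n .{{_ : NonZero n}} → 0# < fromℕ n
  0<fromℕ (suc zero)    = <-respʳ-≈ (sym (+-identityʳ 1#)) 0<1
  0<fromℕ (suc (suc n)) = +-pos 0<1 (0<fromℕ (suc n))

  ^-pos : ∀ {x} j → 0# < x → 0# < x ^ j
  ^-pos zero    0<x = 0<1
  ^-pos (suc j) 0<x = *-pos 0<x (^-pos j 0<x)

  fromℕ#0 : ∀ n .{{_ : NonZero n}} → fromℕ n # 0#
  fromℕ#0 n = 0<⇒#0 (0<fromℕ n)

  #⇒-#0 : ∀ {x y} → x # y → x - y # 0#
  #⇒-#0 {x} {y} x#y with #⇒invertible x#y
  ... | (z , zd≈1 , dz≈1) =
    invertible⇒# (z , trans (*-congˡ (HCR.x-0≈x (x - y))) zd≈1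
                    , trans (*-congʳ (HCR.x-0≈x (x - y))) dz≈1)

  -- #⇒invertible x#0 inverts x - 0# rather than x; the two agree up to _≈_.
  recip : ∀ {x} → x # 0# → ℝ
  recip x#0 = proj₁ (#⇒invertible x#0)

  IsSqrt : ℝ → ℝ → Set (ℓ₁ ⊔ ℓ₂)
  IsSqrt x r = 0# ≤ r × r * r ≈ x

  ∑₀ : (ℕ → ℝ) → ℕ → ℝ
  ∑₀ f zero    = 0#
  ∑₀ f (suc N) = ∑₀ f N + f N

  cosTerm : ℝ → ℕ → ℝ
  cosTerm t m = (- 1#) ^ m * t ^ (2 ℕ.* m)
              * recip (fromℕ#0 ((2 ℕ.* m) !) {{(2 ℕ.* m) !≢0}})

  IsCos : ℝ → ℝ → Set (c ⊔ ℓ₂)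
  IsCos t y = ∑₀ (cosTerm t) ⟶ᴿ y

  -- π is twice the first positive zero of the cosine.
  record IsPi (π : ℝ) : Set (c ⊔ ℓ₁ ⊔ ℓ₂) where
    field
      0<π         : 0# < π
      cos-half    : IsCos (π * recip (0<⇒#0 0<2)) 0#
      cos-earlier : ∀ t → 0# ≤ t → t < π * recip (0<⇒#0 0<2) →
                    ∀ y → IsCos t y → 0# < y

  record ℂ : Set c where
    constructor _+i_
    field
      re im : ℝ
  open ℂ public

  infix  4 _≈ᶜ_
  infixl 6 _+ᶜ_ _-ᶜ_
  infixl 7 _*ᶜ_ _·_ _/_[_] _/ᶜ_[_]

  _≈ᶜ_ : ℂ → ℂ → Set ℓ₁
  z ≈ᶜ u = re z ≈ re u × im z ≈ im u

  ι : ℝ → ℂ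
  ι x = x +i 0#

  𝕚 : ℂ
  𝕚 = 0# +i 1#

  _+ᶜ_ _-ᶜ_ _*ᶜ_ : ℂ → ℂ → ℂ
  z +ᶜ u = (re z + re u) +i (im z + im u)
  z -ᶜ u = (re z - re u) +i (im z - im u)
  z *ᶜ u = (re z * re u - im z * im u) +i (re z * im u + im z * re u)

  _·_ : ℝ → ℂ → ℂ
  x · z = (x * re z) +i (x * im z)

  normSq : ℂ → ℝ
  normSq z = re z * re z + im z * im z

  infix 4 ∣_∣≤_
  ∣_∣≤_ : ℂ → ℝ → Set ℓ₂
  ∣ z ∣≤ r = 0# ≤ r × normSq z ≤ r * r

  infix 4 _≢0
  _≢0 : ℂ → Set ℓ₂
  z ≢0 = 0# < normSq z

  _/_[_] : ℂ → (x : ℝ) → x # 0# → ℂ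
  z / x [ x#0 ] = recip x#0 · z

  _/ᶜ_[_] : ℂ → (u : ℂ) → u ≢0 → ℂ
  z /ᶜ u [ u≢0 ] = (z *ᶜ (re u +i (- im u))) / normSq u [ 0<⇒#0 u≢0 ]

  infix 4 _⟶_
  _⟶_ : (ℕ → ℂ) → ℂ → Set (c ⊔ ℓ₂)
  z ⟶ L = ∀ ε → 0# < ε → ∃[ N ] (∀ n → N ℕ.≤ n → ∣ z n -ᶜ L ∣≤ ε)

  Terms : Set c
  Terms = (n : ℕ) → .{{_ : NonZero n}} → ℂ

  -- ∑ f N = f 1 + … + f N
  ∑ : Terms → ℕ → ℂ
  ∑ f zero    = ι 0#
  ∑ f (suc N) = ∑ f N +ᶜ f (suc N)

  HasSum : Terms → ℂ → Set (c ⊔ ℓ₂)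
  HasSum f S = ∑ f ⟶ S

  -- y = m ^ e for a positive integer m and a real exponent e: for all rational
  -- exponents, m ^ ((p - r) / q) ≤ y if (p - r) / q ≤ e, and dually.  The
  -- inequalities are multiplied out so that only natural exponents occur.
  record IsPower (m : ℕ) (e y : ℝ) : Set ℓ₂ where
    field
      positive : 0# < y
      above    : ∀ p r q .{{_ : NonZero q}} → fromℕ p ≤ fromℕ r + fromℕ q * e →
                 fromℕ m ^ p ≤ fromℕ m ^ r * y ^ q
      below    : ∀ p r q .{{_ : NonZero q}} → fromℕ r + fromℕ q * e ≤ fromℕ p →
                 fromℕ m ^ r * y ^ q ≤ fromℕ m ^ p

  infix 4 _isℴ_
  -- A k = o(|k| ^ e) as k → ±∞
  _isℴ_ : (ℤ → ℂ) → ℝ → Set (c ⊔ ℓ₂)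
  A isℴ e = ∀ ε → 0# < ε → ∃[ N ] (∀ k → N ℕ.< ∣ k ∣ →
              ∃[ y ] IsPower ∣ k ∣ e y × ∣ A k ∣≤ ε * y)

  -- For this relation and the next two: the defining expression makes sense, its
  -- series converges, and v is its value.
  IsDirichlet : (ℤ → ℂ) → ℕ → ℂ → Set (c ⊔ ℓ₂)
  IsDirichlet A j v =
    HasSum (λ k → A (ℤ.+ k) / fromℕ k ^ j [ 0<⇒#0 (^-pos j (0<fromℕ k)) ]) v

  -- v = cot(z; A), read off from the expression for π cot(π s; A) with π s = z
  record IsCot (π : ℝ) (A : ℤ → ℂ) (z v : ℂ) : Set (c ⊔ ℓ₁ ⊔ ℓ₂) where
    field
      s       : ℂ
      πs≈z    : π · s ≈ᶜ z
      s≢0     : s ≢0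
      k²-s²≢0 : ∀ k .{{_ : NonZero k}} → (ι (fromℕ k ^ 2) -ᶜ s *ᶜ s) ≢0
      S       : ℂ
      hasSum  : HasSum (λ k → A (ℤ.+ k) /ᶜ (ι (fromℕ k ^ 2) -ᶜ s *ᶜ s) [ k²-s²≢0 k ]) S
      value   : π · v ≈ᶜ A (ℤ.+ 0) /ᶜ s [ s≢0 ] -ᶜ 2# · (s *ᶜ S)

  IsCoth : ℝ → (ℤ → ℂ) → ℂ → ℂ → Set (c ⊔ ℓ₁ ⊔ ℓ₂)
  IsCoth π A z v = ∃[ u ] IsCot π A (𝕚 *ᶜ z) u × v ≈ᶜ 𝕚 *ᶜ u

{-# OPTIONS --safe #-}

-- Both sides are bilinear in (A , B), so everything is reduced to real sequences by
-- taking real and imaginary parts.  Merging F n and G n by partial fractions leaves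
-- simple series, which cancel the terms with D(2), and
--   2 w (Σ_m a_m r_m Σ_n b_n h_mn - Σ_n b_n ρ_n Σ_m a_m h_mn)
-- where r_m = 1/(w - m²β), ρ_n = 1/(w + n²α), h_mn = 1/(m²β + n²α).  Since
-- (r_m - ρ_n) h_mn = r_m ρ_n, the square m, n ≤ N contributes exactly a product of
-- partial sums of the series for cot and coth.  The remaining tails vanish because
-- h_mn is at most 1/(m²β) and 1/(n²α), so they are bounded by tails of Σ |a_m|/m² and
-- Σ |b_n|/n².  These converge by comparison with a telescoping series.
module Submission where

open import Defs
open import Algebra.Bundles using (CommutativeRing)
open import Algebra.Solver.Ring.AlmostCommutativeRing using (fromCommutativeRing; _-Raw-AlmostCommutative⟶_)
import Algebra.Apartness.Properties.HeytingCommutativeRing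
import Algebra.Properties.AbelianGroup
import Algebra.Properties.CommutativeSemiring.Exp
import Algebra.Properties.Ring
import Algebra.Properties.Semiring.Exp
import Algebra.Properties.Semiring.Mult.TCOptimised
import Algebra.Solver.Ring
open import Data.Empty using (⊥-elim; ⊥-elim-irr)
open import Data.Integer.Base as ℤ using (ℤ)
import Data.Integer.Properties as ℤ
open import Data.Maybe.Base using (Maybe; just; nothing)
open import Data.Nat.Base as ℕ using (ℕ; zero; suc; NonZero)
import Data.Nat.Properties as ℕ
open import Data.Product.Base using (∃-syntax; Σ-syntax; _×_; _,_; proj₁; proj₂)
open import Data.Sum.Base using (_⊎_; inj₁; inj₂; [_,_]′)
open import Level using (_⊔_)
import Relation.Binary.PropositionalEquality.Core as ≡
import Relation.Binary.Reasoning.Setoid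
open import Relation.Nullary using (¬_; yes; no)

-- The series of F and of G need not converge separately: for a_n = n^c and b_n = n^d their terms
-- can be of order n^(c + d - 1). Their partial sums are therefore cut at the same N, and merging F
-- n with G n lowers the coefficients of coth(n α; A) b_n and coth(n β; B) a_n from order 1/n to
-- order 1/n³. The relation α β = π² makes both families of coth values series in the one matrix
-- h_mn: coth(n α; A) sums its n-th column, coth(n β; B) its n-th row. The bounds of h_mn are
-- uniform in the index held fixed, so the tails of all rows, or of all columns, vanish together.
-- Real powers are given only through rational bounds, so Σ k^e / k² has no integral at hand to be
-- compared with. For e ≤ 1 - 1/q the product of the factors 1 - 1/(q j) replaces k^(-1/q):
-- Bernoulli's inequality pins its q-th power between constant multiples of 1/k. The order is not
-- decidable, so absolute values are pairs of inequalities and finite maxima are replaced by sums.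

module Proof {c ℓ₁ ℓ₂} (𝓡 : CompleteOrderedField c ℓ₁ ℓ₂) where

  open Analysis 𝓡

  private
    module CR = CommutativeRing commutativeRing
    module HCR = Algebra.Apartness.Properties.HeytingCommutativeRing heytingCommutativeRing
    module RP = Algebra.Properties.Ring CR.ring
    module AG = Algebra.Properties.AbelianGroup CR.+-abelianGroup
    module Mult′ = Algebra.Properties.Semiring.Mult.TCOptimised CR.semiring
    module ≈-Reasoning = Relation.Binary.Reasoning.Setoid CR.setoid
  open Algebra.Properties.Semiring.Exp CR.semiring using (^-congˡ)
  open Algebra.Properties.CommutativeSemiring.Exp CR.commutativeSemiring using (^-distrib-*)

  -- Ring normalisation with integer coefficients

  -- The optimised multiple sends 1 to `1#` and 2 to `2#` by computation, whereas `fromℕ 1` is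
  -- `1# + 0#`. Numerals in solved identities thus match the constants of the statement.
  fromℤ : ℤ → ℝ
  fromℤ (ℤ.+ n)      = n Mult′.× 1#
  fromℤ (ℤ.-[1+ n ]) = - (suc n Mult′.× 1#)

  fromℤ-neg : ∀ i → fromℤ (ℤ.- i) ≈ - fromℤ i
  fromℤ-neg (ℤ.+ zero)    = sym RP.-0#≈0#
  fromℤ-neg (ℤ.+ (suc n)) = refl
  fromℤ-neg (ℤ.-[1+ n ])  = sym (RP.-‿involutive _)

  fromℤ-⊖ : ∀ m n → fromℤ (m ℤ.⊖ n) ≈ m Mult′.× 1# - n Mult′.× 1#
  fromℤ-⊖ zero    zero    = sym (-‿inverseʳ 0#)
  fromℤ-⊖ zero    (suc n) = sym (+-identityˡ _)
  fromℤ-⊖ (suc m) zero    = sym (HCR.x-0≈x _)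
  fromℤ-⊖ (suc m) (suc n) rewrite ℤ.[1+m]⊖[1+n]≡m⊖n m n = begin
    fromℤ (m ℤ.⊖ n)                                    ≈⟨ fromℤ-⊖ m n ⟩
    x - y                                              ≈⟨ +-congʳ (sym (+-identityʳ x)) ⟩
    x + 0# - y                                         ≈⟨ +-congʳ (+-congˡ (sym (-‿inverseʳ 1#))) ⟩
    x + (1# - 1#) - y                                  ≈⟨ +-congʳ (sym (+-assoc x 1# (- 1#))) ⟩
    x + 1# - 1# - y                                    ≈⟨ +-assoc (x + 1#) (- 1#) (- y) ⟩
    x + 1# + (- 1# - y)                                ≈⟨ +-cong (+-comm x 1#) (AG.⁻¹-∙-comm 1# y) ⟩
    1# + x - (1# + y)                                  ≈⟨ sym (+-cong (Mult′.1+× m 1#) (-‿cong (Mult′.1+× n 1#))) ⟩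
    suc m Mult′.× 1# - suc n Mult′.× 1#                ∎
    where
    open ≈-Reasoning
    x = m Mult′.× 1#
    y = n Mult′.× 1#

  fromℤ-+ : ∀ i j → fromℤ (i ℤ.+ j) ≈ fromℤ i + fromℤ j
  fromℤ-+ (ℤ.+ m)      (ℤ.+ n)      = Mult′.×-homo-+ 1# m n
  fromℤ-+ (ℤ.+ m)      (ℤ.-[1+ n ]) = fromℤ-⊖ m (suc n)
  fromℤ-+ (ℤ.-[1+ m ]) (ℤ.+ n)      = trans (fromℤ-⊖ n (suc m)) (+-comm _ _)
  fromℤ-+ (ℤ.-[1+ m ]) (ℤ.-[1+ n ]) = begin
    - (suc (suc (m ℕ.+ n)) Mult′.× 1#)                  ≡⟨ ≡.cong (λ k → - (suc k Mult′.× 1#)) (ℕ.+-suc m n) ⟨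
    - ((suc m ℕ.+ suc n) Mult′.× 1#)                    ≈⟨ -‿cong (Mult′.×-homo-+ 1# (suc m) (suc n)) ⟩
    - (suc m Mult′.× 1# + suc n Mult′.× 1#)             ≈⟨ sym (AG.⁻¹-∙-comm _ _) ⟩
    - (suc m Mult′.× 1#) - suc n Mult′.× 1#             ∎
    where open ≈-Reasoning

  fromℤ-*-+ : ∀ m j → fromℤ (ℤ.+ m ℤ.* j) ≈ fromℤ (ℤ.+ m) * fromℤ j
  fromℤ-*-+ m (ℤ.+ n) rewrite ≡.sym (ℤ.pos-* m n) = Mult′.×1-homo-* m n
  fromℤ-*-+ m (ℤ.-[1+ n ]) = begin
    fromℤ (ℤ.+ m ℤ.* ℤ.-[1+ n ])              ≡⟨ ≡.cong fromℤ (ℤ.neg-distribʳ-* (ℤ.+ m) (ℤ.+ suc n)) ⟨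
    fromℤ (ℤ.- (ℤ.+ m ℤ.* ℤ.+ suc n))         ≈⟨ fromℤ-neg (ℤ.+ m ℤ.* ℤ.+ suc n) ⟩
    - fromℤ (ℤ.+ m ℤ.* ℤ.+ suc n)             ≈⟨ -‿cong (fromℤ-*-+ m (ℤ.+ suc n)) ⟩
    - (fromℤ (ℤ.+ m) * fromℤ (ℤ.+ suc n))     ≈⟨ RP.-‿distribʳ-* _ _ ⟩
    fromℤ (ℤ.+ m) * - fromℤ (ℤ.+ suc n)       ∎
    where open ≈-Reasoning

  fromℤ-* : ∀ i j → fromℤ (i ℤ.* j) ≈ fromℤ i * fromℤ j
  fromℤ-* (ℤ.+ m)      j = fromℤ-*-+ m j
  fromℤ-* (ℤ.-[1+ m ]) j = begin
    fromℤ (ℤ.-[1+ m ] ℤ.* j)                  ≡⟨ ≡.cong fromℤ (ℤ.neg-distribˡ-* (ℤ.+ suc m) j) ⟨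
    fromℤ (ℤ.- (ℤ.+ suc m ℤ.* j))             ≈⟨ fromℤ-neg (ℤ.+ suc m ℤ.* j) ⟩
    - fromℤ (ℤ.+ suc m ℤ.* j)                 ≈⟨ -‿cong (fromℤ-*-+ (suc m) j) ⟩
    - (fromℤ (ℤ.+ suc m) * fromℤ j)           ≈⟨ RP.-‿distribˡ-* _ _ ⟩
    - fromℤ (ℤ.+ suc m) * fromℤ j             ∎
    where open ≈-Reasoning

  fromℤ-morphism : ℤ.+-*-rawRing -Raw-AlmostCommutative⟶ fromCommutativeRing commutativeRing
  fromℤ-morphism = record
    { ⟦_⟧    = fromℤ
    ; +-homo = fromℤ-+
    ; *-homo = fromℤ-*
    ; -‿homo = fromℤ-neg
    ; 0-homo = refl
    ; 1-homo = refl
    }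

  fromℤ-≟ : ∀ i j → Maybe (fromℤ i ≈ fromℤ j)
  fromℤ-≟ i j with i ℤ.≟ j
  ... | yes ≡.refl = just refl
  ... | no  _      = nothing

  open Algebra.Solver.Ring ℤ.+-*-rawRing (fromCommutativeRing commutativeRing) fromℤ-morphism fromℤ-≟
    using (Polynomial; solve; _:=_; _:+_; _:*_; _:-_; :-_; _:^_; con)

  :0 :1 :2 : ∀ {n} → Polynomial n
  :0 = con (ℤ.+ 0)
  :1 = con (ℤ.+ 1)
  :2 = con (ℤ.+ 2)

  -- Order

  <⇒0<- : ∀ {x y} → x < y → 0# < y - x
  <⇒0<- {x} {y} x<y = <-respˡ-≈ (-‿inverseʳ x) (+-monoˡ-< (- x) x<y)

  0<-⇒< : ∀ {x y} → 0# < y - x → x < y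
  0<-⇒< {x} {y} p = <-respˡ-≈ (+-identityˡ x)
    (<-respʳ-≈ (solve 2 (λ x y → y :- x :+ x := y) refl x y) (+-monoˡ-< x p))

  -- Cotransitivity of apartness, with a wrongly oriented half repaired by transitivity. It stands
  -- in for deciding how z compares with x and y.
  <-cotrans : ∀ {x y} z → x < y → x < z ⊎ z < y
  <-cotrans z x<y with #-cotrans (<⇒# x<y) z
  ... | inj₁ x#z with #⇒<⊎> x#z
  ...   | inj₁ x<z = inj₁ x<z
  ...   | inj₂ z<x = inj₂ (<-trans z<x x<y)
  <-cotrans z x<y | inj₂ z#y with #⇒<⊎> z#y
  ...   | inj₁ z<y = inj₂ z<y
  ...   | inj₂ y<z = inj₁ (<-trans x<y y<z)

  <⇒≤ : ∀ {x y} → x < y → x ≤ y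
  <⇒≤ x<y y<x = <-irrefl refl (<-trans x<y y<x)

  ≤-reflexive : ∀ {x y} → x ≈ y → x ≤ y
  ≤-reflexive x≈y y<x = <-irrefl (sym x≈y) y<x

  ≤-refl : ∀ {x} → x ≤ x
  ≤-refl = ≤-reflexive refl

  ≤-trans : ∀ {x y z} → x ≤ y → y ≤ z → x ≤ z
  ≤-trans {y = y} x≤y y≤z z<x = [ y≤z , x≤y ]′ (<-cotrans y z<x)

  <-≤-trans : ∀ {x y z} → x < y → y ≤ z → x < z
  <-≤-trans {z = z} x<y y≤z = [ (λ x<z → x<z) , (λ z<y → ⊥-elim (y≤z z<y)) ]′ (<-cotrans z x<y)

  ≤-<-trans : ∀ {x y z} → x ≤ y → y < z → x < z
  ≤-<-trans {x = x} x≤y y<z = [ (λ y<x → ⊥-elim (x≤y y<x)) , (λ x<z → x<z) ]′ (<-cotrans x y<z)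

  ≤-antisym : ∀ {x y} → x ≤ y → y ≤ x → x ≈ y
  ≤-antisym x≤y y≤x = proj₁ (tight _ _) λ x#y → [ y≤x , x≤y ]′ (#⇒<⊎> x#y)

  ≤-resp : ∀ {x x′ y y′} → x ≈ x′ → y ≈ y′ → x ≤ y → x′ ≤ y′
  ≤-resp x≈x′ y≈y′ x≤y y′<x′ = x≤y (<-respʳ-≈ (sym x≈x′) (<-respˡ-≈ (sym y≈y′) y′<x′))

  +-monoˡ-≤ : ∀ {x y} z → x ≤ y → x + z ≤ y + z
  +-monoˡ-≤ {x} {y} z x≤y p = x≤y (<-respˡ-≈ (cancel y) (<-respʳ-≈ (cancel x) (+-monoˡ-< (- z) p)))
    where
    cancel : ∀ u → u + z - z ≈ u
    cancel u = solve 2 (λ u z → u :+ z :- z := u) refl u z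

  ≤⇒0≤- : ∀ {x y} → x ≤ y → 0# ≤ y - x
  ≤⇒0≤- {x} x≤y = ≤-resp (-‿inverseʳ x) refl (+-monoˡ-≤ (- x) x≤y)

  0≤-⇒≤ : ∀ {x y} → 0# ≤ y - x → x ≤ y
  0≤-⇒≤ {x} {y} p = ≤-resp (+-identityˡ x) (solve 2 (λ x y → y :- x :+ x := y) refl x y) (+-monoˡ-≤ x p)

  +-mono-≤ : ∀ {x y u v} → x ≤ y → u ≤ v → x + u ≤ y + v
  +-mono-≤ {y = y} {u} x≤y u≤v =
    ≤-trans (+-monoˡ-≤ u x≤y) (≤-resp (+-comm _ _) (+-comm _ _) (+-monoˡ-≤ y u≤v))

  +-nonneg : ∀ {x y} → 0# ≤ x → 0# ≤ y → 0# ≤ x + y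
  +-nonneg 0≤x 0≤y = ≤-resp (+-identityˡ 0#) refl (+-mono-≤ 0≤x 0≤y)

  neg-mono-≤ : ∀ {x y} → x ≤ y → - y ≤ - x
  neg-mono-≤ {x} {y} x≤y = 0≤-⇒≤ (≤-resp refl (solve 2 (λ x y → y :- x := :- x :- :- y) refl x y) (≤⇒0≤- x≤y))

  -- The goal is a negation, so 0 < x and 0 < y may be assumed under a double negation: x ≤ 0 would
  -- force x ≈ 0 and a vanishing product.
  *-nonneg : ∀ {x y} → 0# ≤ x → 0# ≤ y → 0# ≤ x * y
  *-nonneg {x} {y} 0≤x 0≤y xy<0 = x≰0 λ 0<x → y≰0 λ 0<y → <⇒≤ (*-pos 0<x 0<y) xy<0
    where
    x≰0 : ¬ x ≤ 0#
    x≰0 x≤0 = <-irrefl (trans (*-congʳ (≤-antisym x≤0 0≤x)) (zeroˡ y)) xy<0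
    y≰0 : ¬ y ≤ 0#
    y≰0 y≤0 = <-irrefl (trans (*-congˡ (≤-antisym y≤0 0≤y)) (zeroʳ x)) xy<0

  *-monoˡ-≤ : ∀ {x y z} → 0# ≤ z → x ≤ y → z * x ≤ z * y
  *-monoˡ-≤ {x} {y} {z} 0≤z x≤y = 0≤-⇒≤
    (≤-resp refl (solve 3 (λ x y z → z :* (y :- x) := z :* y :- z :* x) refl x y z) (*-nonneg 0≤z (≤⇒0≤- x≤y)))

  *-monoʳ-≤ : ∀ {x y z} → 0# ≤ z → x ≤ y → x * z ≤ y * z
  *-monoʳ-≤ 0≤z x≤y = ≤-resp (*-comm _ _) (*-comm _ _) (*-monoˡ-≤ 0≤z x≤y)

  *-mono-≤ : ∀ {x y u v} → 0# ≤ x → 0# ≤ v → x ≤ y → u ≤ v → x * u ≤ y * v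
  *-mono-≤ 0≤x 0≤v x≤y u≤v = ≤-trans (*-monoˡ-≤ 0≤x u≤v) (*-monoʳ-≤ 0≤v x≤y)

  *-monoˡ-< : ∀ {x y z} → 0# < z → x < y → z * x < z * y
  *-monoˡ-< {x} {y} {z} 0<z x<y = 0<-⇒<
    (<-respʳ-≈ (solve 3 (λ x y z → z :* (y :- x) := z :* y :- z :* x) refl x y z) (*-pos 0<z (<⇒0<- x<y)))

  *-cancelˡ-≤ : ∀ {x y z} → 0# < z → z * x ≤ z * y → x ≤ y
  *-cancelˡ-≤ 0<z zx≤zy y<x = zx≤zy (*-monoˡ-< 0<z y<x)

  *-cancelˡ-≈ : ∀ {x y z} → 0# < z → z * x ≈ z * y → x ≈ y
  *-cancelˡ-≈ 0<z zx≈zy = ≤-antisym (*-cancelˡ-≤ 0<z (≤-reflexive zx≈zy)) (*-cancelˡ-≤ 0<z (≤-reflexive (sym zx≈zy)))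

  square-nonneg : ∀ x → 0# ≤ x * x
  square-nonneg x xx<0 = x≱0 λ x<0 → x≰0 λ 0<x → <⇒≤ x<0 0<x
    where
    x≱0 : ¬ 0# ≤ x
    x≱0 0≤x = *-nonneg 0≤x 0≤x xx<0
    x≰0 : ¬ x ≤ 0#
    x≰0 x≤0 = *-nonneg 0≤-x 0≤-x (<-respˡ-≈ (solve 1 (λ x → x :* x := :- x :* :- x) refl x) xx<0)
      where
      0≤-x : 0# ≤ - x
      0≤-x = ≤-resp RP.-0#≈0# refl (neg-mono-≤ x≤0)

  square-cancel-≤ : ∀ {x y} → 0# ≤ y → x * x ≤ y * y → x ≤ y
  square-cancel-≤ {x} {y} 0≤y xx≤yy y<x = xx≤yy (0<-⇒< (<-respʳ-≈
    (solve 2 (λ x y → (x :- y) :* (x :+ y) := x :* x :- y :* y) refl x y)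
    (*-pos (<⇒0<- y<x) (<-≤-trans (≤-<-trans 0≤y y<x) (≤-resp (+-identityʳ x) refl (+-mono-≤ ≤-refl 0≤y))))))

  -- Reciprocals, powers and equations modulo hypotheses

  recip-inverseʳ : ∀ {x} (x#0 : x # 0#) → x * recip x#0 ≈ 1#
  recip-inverseʳ {x} x#0 = trans (*-congʳ (sym (HCR.x-0≈x x))) (proj₂ (proj₂ (#⇒invertible x#0)))

  inverse-unique : ∀ {x r s} → x * r ≈ 1# → x * s ≈ 1# → r ≈ s
  inverse-unique {x} {r} {s} xr≈1 xs≈1 = begin
    r            ≈⟨ solve 1 (λ r → r := r :* :1) refl r ⟩
    r * 1#       ≈⟨ *-congˡ (sym xs≈1) ⟩
    r * (x * s)  ≈⟨ solve 3 (λ x r s → r :* (x :* s) := x :* r :* s) refl x r s ⟩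
    x * r * s    ≈⟨ *-congʳ xr≈1 ⟩
    1# * s       ≈⟨ *-identityˡ s ⟩
    s            ∎
    where open ≈-Reasoning

  -- An invertible r is apart from 0, which decides its sign; a negative r would make 1 ≈ x r
  -- negative.
  inverse-pos : ∀ {x r} → x * r ≈ 1# → 0# < x → 0# < r
  inverse-pos {x} {r} xr≈1 0<x with #⇒<⊎> (HCR.invertibleʳ⇒# (x , trans (*-congʳ (HCR.x-0≈x r))
      (trans (*-comm r x) xr≈1)))
  ... | inj₂ 0<r = 0<r
  ... | inj₁ r<0 = ⊥-elim (<⇒≤ 0<1 (<-respˡ-≈ xr≈1 (<-respʳ-≈ (zeroʳ x) (*-monoˡ-< 0<x r<0))))

  recip⁺ : ∀ {x} → 0# < x → ℝ
  recip⁺ 0<x = recip (0<⇒#0 0<x)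

  recip⁺-inverseʳ : ∀ {x} (0<x : 0# < x) → x * recip⁺ 0<x ≈ 1#
  recip⁺-inverseʳ 0<x = recip-inverseʳ (0<⇒#0 0<x)

  recip⁺-pos : ∀ {x} (0<x : 0# < x) → 0# < recip⁺ 0<x
  recip⁺-pos 0<x = inverse-pos (recip⁺-inverseʳ 0<x) 0<x

  -- Proves x ≈ y from p ≈ q when x - y is a multiple of p - q in the ring, so that an
  -- equation modulo hypotheses becomes a ring identity with explicit cofactors.
  ≈-modulo : ∀ {x y p q} k → p ≈ q → x ≈ y + k * (p - q) → x ≈ y
  ≈-modulo {x} {y} {p} {q} k p≈q e = trans e (trans (+-congˡ (trans (*-congˡ
      (trans (+-congʳ p≈q) (-‿inverseʳ q))) (zeroʳ k))) (+-identityʳ y))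

  ^-nonneg : ∀ {x} n → 0# ≤ x → 0# ≤ x ^ n
  ^-nonneg zero    0≤x = <⇒≤ 0<1
  ^-nonneg (suc n) 0≤x = *-nonneg 0≤x (^-nonneg n 0≤x)

  ^-mono-≤ : ∀ {x y} n → 0# ≤ x → x ≤ y → x ^ n ≤ y ^ n
  ^-mono-≤ zero    0≤x x≤y = ≤-refl
  ^-mono-≤ (suc n) 0≤x x≤y = *-mono-≤ 0≤x (^-nonneg n (≤-trans 0≤x x≤y)) x≤y (^-mono-≤ n 0≤x x≤y)

  ^-mono-< : ∀ {x y} n .{{_ : NonZero n}} → 0# ≤ x → x < y → x ^ n < y ^ n
  ^-mono-< {x} {y} (suc n) 0≤x x<y = ≤-<-trans (*-monoˡ-≤ 0≤x (^-mono-≤ n 0≤x (<⇒≤ x<y)))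
    (<-respˡ-≈ (*-comm _ _) (<-respʳ-≈ (*-comm _ _) (*-monoˡ-< (^-pos n (≤-<-trans 0≤x x<y)) x<y)))

  0≤fromℕ : ∀ n → 0# ≤ fromℕ n
  0≤fromℕ zero    = ≤-refl
  0≤fromℕ (suc n) = <⇒≤ (0<fromℕ (suc n))

  fromℕ-mono-≤ : ∀ {m n} → m ℕ.≤ n → fromℕ m ≤ fromℕ n
  fromℕ-mono-≤ {n = n} ℕ.z≤n   = 0≤fromℕ n
  fromℕ-mono-≤ (ℕ.s≤s m≤n) = +-mono-≤ ≤-refl (fromℕ-mono-≤ m≤n)

  -- Bounds on absolute values

  -- ∣ x ∣ ≤ y
  infix 4 _≼_
  _≼_ : ℝ → ℝ → Set ℓ₂
  x ≼ y = x ≤ y × - x ≤ y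

  0≤x+x⇒0≤x : ∀ {x} → 0# ≤ x + x → 0# ≤ x
  0≤x+x⇒0≤x 0≤x+x x<0 = 0≤x+x (<-respʳ-≈ (+-identityˡ 0#) (<-trans (+-monoˡ-< _ x<0)
    (<-respˡ-≈ (+-comm _ _) (+-monoˡ-< 0# x<0))))

  ≼⇒0≤ : ∀ {x y} → x ≼ y → 0# ≤ y
  ≼⇒0≤ {x} (x≤y , -x≤y) = 0≤x+x⇒0≤x (≤-resp (-‿inverseʳ x) refl (+-mono-≤ x≤y -x≤y))

  ≼-resp : ∀ {x x′ y y′} → x ≈ x′ → y ≈ y′ → x ≼ y → x′ ≼ y′
  ≼-resp x≈x′ y≈y′ (x≤y , -x≤y) = ≤-resp x≈x′ y≈y′ x≤y , ≤-resp (-‿cong x≈x′) y≈y′ -x≤y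

  ≼-≤-trans : ∀ {x y z} → x ≼ y → y ≤ z → x ≼ z
  ≼-≤-trans (x≤y , -x≤y) y≤z = ≤-trans x≤y y≤z , ≤-trans -x≤y y≤z

  ≼-+ : ∀ {x y u v} → x ≼ y → u ≼ v → x + u ≼ y + v
  ≼-+ (x≤y , -x≤y) (u≤v , -u≤v) = +-mono-≤ x≤y u≤v , ≤-resp (AG.⁻¹-∙-comm _ _) refl (+-mono-≤ -x≤y -u≤v)

  ≼-neg : ∀ {x y} → x ≼ y → - x ≼ y
  ≼-neg (x≤y , -x≤y) = -x≤y , ≤-resp (sym (RP.-‿involutive _)) refl x≤y

  nonneg⇒≼ : ∀ {x} → 0# ≤ x → x ≼ x
  nonneg⇒≼ 0≤x = ≤-refl , ≤-trans (≤-resp refl RP.-0#≈0# (neg-mono-≤ 0≤x)) 0≤x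

  0≼ : ∀ {y} → 0# ≤ y → 0# ≼ y
  0≼ 0≤y = 0≤y , ≤-resp (sym RP.-0#≈0#) refl 0≤y

  -- Twice the gap y v - x u is (y - x)(v + u) + (y + x)(v - u), whose factors are all nonnegative.
  -- No case distinction on signs arises.
  *-≼-≤ : ∀ {x y u v} → x ≼ y → u ≼ v → x * u ≤ y * v
  *-≼-≤ {x} {y} {u} {v} (x≤y , -x≤y) (u≤v , -u≤v) = 0≤-⇒≤ (0≤x+x⇒0≤x (≤-resp refl
    (solve 4 (λ x y u v → (y :- x) :* (v :- :- u) :+ (y :- :- x) :* (v :- u)
                            := y :* v :- x :* u :+ (y :* v :- x :* u)) refl x y u v)
    (+-nonneg (*-nonneg (≤⇒0≤- x≤y) (≤⇒0≤- -u≤v)) (*-nonneg (≤⇒0≤- -x≤y) (≤⇒0≤- u≤v)))))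

  ≼-* : ∀ {x y u v} → x ≼ y → u ≼ v → x * u ≼ y * v
  ≼-* x≼y u≼v = *-≼-≤ x≼y u≼v , ≤-resp (sym (RP.-‿distribˡ-* _ _)) refl (*-≼-≤ (≼-neg x≼y) u≼v)

  square-≤⇒≼ : ∀ {x y} → 0# ≤ y → x * x ≤ y * y → x ≼ y
  square-≤⇒≼ {x} 0≤y xx≤yy = square-cancel-≤ 0≤y xx≤yy
    , square-cancel-≤ 0≤y (≤-resp (solve 1 (λ x → x :* x := :- x :* :- x) refl x) refl xx≤yy)

  -- An explicit bound for the absolute value of x that needs neither a maximum nor a square root.
  ≼-1+square : ∀ x → x ≼ 1# + x * x
  ≼-1+square x = square-≤⇒≼ (+-nonneg (<⇒≤ 0<1) (square-nonneg x)) (0≤-⇒≤ (≤-resp refl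
    (solve 1 (λ x → :1 :+ x :* x :+ x :* x :* (x :* x) := (:1 :+ x :* x) :* (:1 :+ x :* x) :- x :* x) refl x)
    (+-nonneg (+-nonneg (<⇒≤ 0<1) (square-nonneg x)) (square-nonneg (x * x)))))

  -- Going down from N, each index newly covered adds `1# + x N * x N` to the constant; the sum
  -- takes the place of a maximum over the initial terms.
  eventually≼⇒≼ : ∀ (x : ℕ → ℝ) N {C} → (∀ n → N ℕ.≤ n → x n ≼ C) → ∃[ C′ ] (∀ n → x n ≼ C′)
  eventually≼⇒≼ x zero    {C} x≼C = C , λ n → x≼C n ℕ.z≤n
  eventually≼⇒≼ x (suc N) {C} x≼C = eventually≼⇒≼ x N {1# + x N * x N + C} bound
    where
    0≤C : 0# ≤ C
    0≤C = ≼⇒0≤ (x≼C (suc N) ℕ.≤-refl)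
    bound : ∀ n → N ℕ.≤ n → x n ≼ 1# + x N * x N + C
    bound n N≤n with ℕ.m≤n⇒m<n∨m≡n N≤n
    ... | inj₁ N<n = ≼-≤-trans (x≼C n N<n) (≤-resp (+-identityˡ C) refl
                       (+-mono-≤ (≼⇒0≤ (≼-1+square (x N))) ≤-refl))
    ... | inj₂ ≡.refl = ≼-≤-trans (≼-1+square (x N)) (≤-resp (+-identityʳ _) refl (+-mono-≤ ≤-refl 0≤C))

  -- Limits

  half : ℝ → ℝ
  half ε = recip⁺ 0<2 * ε

  half-pos : ∀ {ε} → 0# < ε → 0# < half ε
  half-pos = *-pos (recip⁺-pos 0<2)

  half+half : ∀ ε → half ε + half ε ≈ ε
  half+half ε = ≈-modulo ε (recip⁺-inverseʳ 0<2)
    (solve 2 (λ h ε → h :* ε :+ h :* ε := ε :+ ε :* (:2 :* h :- :1)) refl (recip⁺ 0<2) ε)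

  ≤-by-ε : ∀ {x y} → (∀ ε → 0# < ε → x - y ≤ ε) → x ≤ y
  ≤-by-ε {x} {y} x-y≤ε y<x = x-y≤ε δ 0<δ (<-respʳ-≈ (half+half (x - y)) (<-respˡ-≈ (+-identityˡ δ) (+-monoˡ-< δ 0<δ)))
    where
    δ = half (x - y)
    0<δ = half-pos (<⇒0<- y<x)

  lim⇒≼ : ∀ {x L} → x ⟶ᴿ L → ∀ ε → 0# < ε → ∃[ N ] (∀ n → N ℕ.≤ n → x n - L ≼ ε)
  lim⇒≼ x⟶L ε 0<ε with x⟶L ε 0<ε
  ... | N , h = N , λ n N≤n → proj₁ (h n N≤n) , ≤-resp (sym (AG.⁻¹-anti-homo-// _ _)) refl (proj₂ (h n N≤n))

  ≼⇒lim : ∀ {x L} → (∀ ε → 0# < ε → ∃[ N ] (∀ n → N ℕ.≤ n → x n - L ≼ ε)) → x ⟶ᴿ L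
  ≼⇒lim x≼ ε 0<ε with x≼ ε 0<ε
  ... | N , h = N , λ n N≤n → proj₁ (h n N≤n) , ≤-resp (AG.⁻¹-anti-homo-// _ _) refl (proj₂ (h n N≤n))

  lim-cong : ∀ {x y L M} → (∀ n → x n ≈ y n) → L ≈ M → x ⟶ᴿ L → y ⟶ᴿ M
  lim-cong x≈y L≈M x⟶L ε 0<ε with x⟶L ε 0<ε
  ... | N , h = N , λ n N≤n → ≤-resp (+-cong (x≈y n) (-‿cong L≈M)) refl (proj₁ (h n N≤n))
                            , ≤-resp (+-cong L≈M (-‿cong (x≈y n))) refl (proj₂ (h n N≤n))

  lim-const : ∀ {L} → (λ _ → L) ⟶ᴿ L
  lim-const {L} ε 0<ε = 0 , λ n _ → bound , bound
    where bound = ≤-resp (sym (-‿inverseʳ L)) refl (<⇒≤ 0<ε)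

  lim-+ : ∀ {x y L M} → x ⟶ᴿ L → y ⟶ᴿ M → (λ n → x n + y n) ⟶ᴿ L + M
  lim-+ {x} {y} {L} {M} x⟶L y⟶M = ≼⇒lim λ ε 0<ε →
    let (N₁ , h₁) = lim⇒≼ x⟶L (half ε) (half-pos 0<ε)
        (N₂ , h₂) = lim⇒≼ y⟶M (half ε) (half-pos 0<ε)
    in N₁ ℕ.⊔ N₂ , λ n N≤n → ≼-resp
         (solve 4 (λ x y L M → x :- L :+ (y :- M) := x :+ y :- (L :+ M)) refl (x n) (y n) L M) (half+half ε)
         (≼-+ (h₁ n (ℕ.≤-trans (ℕ.m≤m⊔n N₁ N₂) N≤n)) (h₂ n (ℕ.≤-trans (ℕ.m≤n⊔m N₁ N₂) N≤n)))

  lim-null-* : ∀ {x y : ℕ → ℝ} {C} → x ⟶ᴿ 0# → (∀ n → y n ≼ C) → (λ n → x n * y n) ⟶ᴿ 0#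
  lim-null-* {x} {y} {C} x⟶0 y≼C = ≼⇒lim λ ε 0<ε →
    -- The tolerance is divided by 1 + C, since C itself may be zero.
    let (N , h) = lim⇒≼ x⟶0 (recip⁺ 0<1+C * ε) (*-pos (recip⁺-pos 0<1+C) 0<ε)
    in N , λ n N≤n → ≼-resp
         (solve 2 (λ x y → (x :- :0) :* y := x :* y :- :0) refl (x n) (y n))
         (≈-modulo ε (recip⁺-inverseʳ 0<1+C)
           (solve 3 (λ r ε C → r :* ε :* (:1 :+ C) := ε :+ ε :* ((:1 :+ C) :* r :- :1)) refl (recip⁺ 0<1+C) ε C))
         (≼-* (h n N≤n) (≼-≤-trans (y≼C n) C≤1+C))
    where
    C≤1+C : C ≤ 1# + C
    C≤1+C = ≤-resp (+-identityˡ C) refl (+-monoˡ-≤ C (<⇒≤ 0<1))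
    0<1+C : 0# < 1# + C
    0<1+C = <-≤-trans 0<1 (≤-resp (+-identityʳ 1#) refl (+-mono-≤ ≤-refl (≼⇒0≤ (y≼C 0))))

  lim⇒null : ∀ {x L} → x ⟶ᴿ L → (λ n → x n - L) ⟶ᴿ 0#
  lim⇒null {L = L} x⟶L = lim-cong (λ _ → refl) (-‿inverseʳ L) (lim-+ x⟶L (lim-const { - L}))

  null⇒lim : ∀ {x L} → (λ n → x n - L) ⟶ᴿ 0# → x ⟶ᴿ L
  null⇒lim {x} {L} x-L⟶0 = lim-cong (λ n → solve 2 (λ x L → x :- L :+ L :=
      x) refl (x n) L) (+-identityˡ L) (lim-+ x-L⟶0 (lim-const {L}))

  lim-scale : ∀ {x L} k → x ⟶ᴿ L → (λ n → k * x n) ⟶ᴿ k * L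
  lim-scale {x} {L} k x⟶L = null⇒lim (lim-cong
    (λ n → solve 3 (λ k x L → (x :- L) :* k := k :* x :- k :* L) refl k (x n) L) refl
    (lim-null-* {y = λ _ → k} (lim⇒null x⟶L) (λ _ → ≼-1+square k)))

  lim-neg : ∀ {x L} → x ⟶ᴿ L → (λ n → - x n) ⟶ᴿ - L
  lim-neg {x} x⟶L = lim-cong (λ n → RP.-1*x≈-x (x n)) (RP.-1*x≈-x _) (lim-scale (- 1#) x⟶L)

  -- By x y - L M = (x - L) y + L (y - M), a bound is wanted for one factor only.
  lim-* : ∀ {x y L M C} → (∀ n → y n ≼ C) → x ⟶ᴿ L → y ⟶ᴿ M → (λ n → x n * y n) ⟶ᴿ L * M
  lim-* {x} {y} {L} {M} y≼C x⟶L y⟶M = lim-cong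
    (λ n → solve 3 (λ x y L → (x :- L) :* y :+ L :* y := x :* y) refl (x n) (y n) L) (+-identityˡ _)
    (lim-+ (lim-null-* (lim⇒null x⟶L) y≼C) (lim-scale L y⟶M))

  squeeze : ∀ {x y} → (∀ n → x n ≼ y n) → y ⟶ᴿ 0# → x ⟶ᴿ 0#
  squeeze {x} x≼y y⟶0 = ≼⇒lim λ ε 0<ε → let (N , h) = y⟶0 ε 0<ε in
    N , λ n N≤n → ≼-resp (sym (HCR.x-0≈x (x n))) refl
      (≼-≤-trans (x≼y n) (≤-resp (HCR.x-0≈x _) refl (proj₁ (h n N≤n))))

  lim-≥ : ∀ {x L b} N → (∀ n → N ℕ.≤ n → b ≤ x n) → x ⟶ᴿ L → b ≤ L
  lim-≥ {x} {L} {b} N b≤x x⟶L = ≤-by-ε λ ε 0<ε → let (N′ , h) = x⟶L ε 0<ε ; n = N ℕ.⊔ N′ in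
    ≤-trans (+-monoˡ-≤ (- L) (b≤x n (ℕ.m≤m⊔n N N′))) (proj₁ (h n (ℕ.m≤n⊔m N N′)))

  lim-≤ : ∀ {x L b} N → (∀ n → N ℕ.≤ n → x n ≤ b) → x ⟶ᴿ L → L ≤ b
  lim-≤ {x} {L} {b} N x≤b x⟶L = ≤-resp (RP.-‿involutive L) (RP.-‿involutive b)
    (neg-mono-≤ (lim-≥ N (λ n N≤n → neg-mono-≤ (x≤b n N≤n)) (lim-neg x⟶L)))

  lim-≼ : ∀ {x L b} N → (∀ n → N ℕ.≤ n → x n ≼ b) → x ⟶ᴿ L → L ≼ b
  lim-≼ N x≼b x⟶L = lim-≤ N (λ n N≤n → proj₁ (x≼b n N≤n)) x⟶L , lim-≤ N (λ n N≤n → proj₂ (x≼b n N≤n)) (lim-neg x⟶L)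

  lim-unique : ∀ {x L M} → x ⟶ᴿ L → x ⟶ᴿ M → L ≈ M
  lim-unique {x} {L} {M} x⟶L x⟶M = ≤-antisym (L≤M x⟶L x⟶M) (L≤M x⟶M x⟶L)
    where
    L≤M : ∀ {L M} → x ⟶ᴿ L → x ⟶ᴿ M → L ≤ M
    L≤M x⟶L x⟶M = 0≤-⇒≤ (lim-≥ 0 (λ n _ → ≤-reflexive (sym (-‿inverseʳ (x n)))) (lim-+ x⟶M (lim-neg x⟶L)))

  -- Finite sums and series

  ∑₀-cong : ∀ {f g} → (∀ n → f n ≈ g n) → ∀ N → ∑₀ f N ≈ ∑₀ g N
  ∑₀-cong f≈g zero    = refl
  ∑₀-cong f≈g (suc N) = +-cong (∑₀-cong f≈g N) (f≈g N)

  ∑₀-+ : ∀ f g N → ∑₀ (λ n → f n + g n) N ≈ ∑₀ f N + ∑₀ g N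
  ∑₀-+ f g zero    = sym (+-identityˡ 0#)
  ∑₀-+ f g (suc N) = trans (+-congʳ (∑₀-+ f g N))
    (solve 4 (λ F G f g → F :+ G :+ (f :+ g) := F :+ f :+ (G :+ g)) refl (∑₀ f N) (∑₀ g N) (f N) (g N))

  ∑₀-minus : ∀ f g N → ∑₀ (λ n → f n - g n) N ≈ ∑₀ f N - ∑₀ g N
  ∑₀-minus f g zero    = sym (-‿inverseʳ 0#)
  ∑₀-minus f g (suc N) = trans (+-congʳ (∑₀-minus f g N))
    (solve 4 (λ F G f g → F :- G :+ (f :- g) := F :+ f :- (G :+ g)) refl (∑₀ f N) (∑₀ g N) (f N) (g N))

  ∑₀-scale : ∀ k f N → ∑₀ (λ n → k * f n) N ≈ k * ∑₀ f N
  ∑₀-scale k f zero    = sym (zeroʳ k)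
  ∑₀-scale k f (suc N) = trans (+-congʳ (∑₀-scale k f N)) (sym (distribˡ k (∑₀ f N) (f N)))

  ∑₀-swap : ∀ (f : ℕ → ℕ → ℝ) M N → ∑₀ (λ m → ∑₀ (f m) N) M ≈ ∑₀ (λ n → ∑₀ (λ m → f m n) M) N
  ∑₀-swap f zero    N = ∑₀-zero N
    where
    ∑₀-zero : ∀ N → 0# ≈ ∑₀ (λ _ → 0#) N
    ∑₀-zero zero    = refl
    ∑₀-zero (suc N) = trans (∑₀-zero N) (sym (+-identityʳ _))
  ∑₀-swap f (suc M) N = trans (+-congʳ (∑₀-swap f M N)) (sym (∑₀-+ _ (f M) N))

  ∑₀-≼ : ∀ {f g} → (∀ n → f n ≼ g n) → ∀ N → ∑₀ f N ≼ ∑₀ g N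
  ∑₀-≼ f≼g zero    = 0≼ ≤-refl
  ∑₀-≼ f≼g (suc N) = ≼-+ (∑₀-≼ f≼g N) (f≼g N)

  ∑₀-block-≼ : ∀ {f g} → (∀ n → f n ≼ g n) → ∀ {M N} → M ℕ.≤′ N → ∑₀ f N - ∑₀ f M ≼ ∑₀ g N - ∑₀ g M
  ∑₀-block-≼ {f} {g} f≼g {M} ℕ.≤′-refl = ≼-resp (sym (-‿inverseʳ _)) (sym (-‿inverseʳ _)) (0≼ ≤-refl)
  ∑₀-block-≼ {f} {g} f≼g {M} (ℕ.≤′-step {N} M≤N) =
    ≼-resp (regroup f) (regroup g) (≼-+ (∑₀-block-≼ f≼g M≤N) (f≼g N))
    where
    regroup : ∀ f → ∑₀ f N - ∑₀ f M + f N ≈ ∑₀ f (suc N) - ∑₀ f M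
    regroup f = solve 3 (λ F F′ f → F :- F′ :+ f := F :+ f :- F′) refl (∑₀ f N) (∑₀ f M) (f N)

  ∑₀≤limit : ∀ {g G} → (∀ n → 0# ≤ g n) → ∑₀ g ⟶ᴿ G → ∀ N → ∑₀ g N ≤ G
  ∑₀≤limit {g} 0≤g g⟶G N = lim-≥ N (λ n N≤n → 0≤-⇒≤ (≼⇒0≤ (∑₀-block-≼ (λ k → nonneg⇒≼ (0≤g k)) (ℕ.≤⇒≤′ N≤n)))) g⟶G

  -- Blocks of x are dominated by blocks of g, so the partial sums are Cauchy. Letting the upper end
  -- of a block tend to infinity keeps the bound, which yields the tail estimate used for every
  -- truncation error.
  comparison : ∀ {x g G} → (∀ n → x n ≼ g n) → ∑₀ g ⟶ᴿ G →
               ∃[ L ] ∑₀ x ⟶ᴿ L × (∀ N → L - ∑₀ x N ≼ G - ∑₀ g N)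
  comparison {x} {g} {G} x≼g g⟶G = L , x⟶L ,
    λ N → lim-≼ N (λ n N≤n → block N≤n) (lim-+ x⟶L (lim-const { - ∑₀ x N}))
    where
    block : ∀ {M N} → M ℕ.≤ N → ∑₀ x N - ∑₀ x M ≼ G - ∑₀ g M
    block {M} {N} M≤N = ≼-≤-trans (∑₀-block-≼ x≼g (ℕ.≤⇒≤′ M≤N))
      (+-monoˡ-≤ (- ∑₀ g M) (∑₀≤limit (λ n → ≼⇒0≤ (x≼g n)) g⟶G N))
    cauchy : IsCauchy (∑₀ x)
    cauchy ε 0<ε with g⟶G ε 0<ε
    ... | N , h = N , within
      where
      ordered : ∀ {m n} → N ℕ.≤ m → m ℕ.≤ n → ∑₀ x n - ∑₀ x m ≼ ε
      ordered N≤m m≤n = ≼-≤-trans (block m≤n) (proj₂ (h _ N≤m))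
      flip : ∀ {u v} → - (u - v) ≤ ε → v - u ≤ ε
      flip = ≤-resp (AG.⁻¹-anti-homo-// _ _) refl
      within : ∀ m n → N ℕ.≤ m → N ℕ.≤ n → Within ε (∑₀ x m) (∑₀ x n)
      within m n N≤m N≤n with ℕ.≤-total m n
      ... | inj₁ m≤n = flip (proj₂ (ordered N≤m m≤n)) , proj₁ (ordered N≤m m≤n)
      ... | inj₂ n≤m = proj₁ (ordered N≤n n≤m) , flip (proj₂ (ordered N≤n n≤m))
    L = proj₁ (complete (∑₀ x) cauchy)
    x⟶L : ∑₀ x ⟶ᴿ L
    x⟶L = proj₂ (complete (∑₀ x) cauchy)

  -- A telescoping majorant for Σ kᵉ / k² with e < 1

  bernoulli : ∀ {y} n → 0# ≤ 1# + y → 1# + fromℕ n * y ≤ (1# + y) ^ n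
  bernoulli {y} zero    0≤1+y = ≤-reflexive (solve 1 (λ y → :1 :+ :0 :* y := :1) refl y)
  bernoulli {y} (suc n) 0≤1+y = ≤-trans
    (0≤-⇒≤ (≤-resp refl
      (solve 2 (λ y N → N :* (y :* y) := (:1 :+ y) :* (:1 :+ N :* y) :- (:1 :+ (:1 :+ N) :* y)) refl y (fromℕ n))
      (*-nonneg (0≤fromℕ n) (square-nonneg y))))
    (*-monoˡ-≤ 0≤1+y (bernoulli n 0≤1+y))

  fromℕ²-pos : ∀ n → 0# < fromℕ (suc n) ^ 2
  fromℕ²-pos n = ^-pos 2 (0<fromℕ (suc n))

  1/k² : ℕ → ℝ
  1/k² n = recip⁺ (fromℕ²-pos n)

  module Majorant (q : ℕ) {{_ : NonZero q}} where

    qj : ℕ → ℝ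
    qj n = fromℕ q * fromℕ (2 ℕ.+ n)

    qj-pos : ∀ n → 0# < qj n
    qj-pos n = *-pos (0<fromℕ q) (0<fromℕ (2 ℕ.+ n))

    step : ℕ → ℝ
    step n = recip⁺ (qj-pos n)

    step-pos : ∀ n → 0# < step n
    step-pos n = recip⁺-pos (qj-pos n)

    step<1 : ∀ n → step n < 1#
    step<1 n = <-respˡ-≈ (*-identityʳ _) (<-respʳ-≈ (trans (*-comm _ _) (recip⁺-inverseʳ (qj-pos n)))
      (*-monoˡ-< (step-pos n) 1<qj))
      where
      1<2+n : 1# < fromℕ (2 ℕ.+ n)
      1<2+n = <-respˡ-≈ (+-identityʳ 1#) (<-respˡ-≈ (+-comm _ _)
          (<-respʳ-≈ (+-comm _ _) (+-monoˡ-< 1# (0<fromℕ (suc n)))))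
      1<qj : 1# < qj n
      1<qj = <-≤-trans 1<2+n (≤-resp (*-identityˡ _) refl (*-monoʳ-≤ (0≤fromℕ (2 ℕ.+ n))
        (≤-resp (+-identityʳ 1#) refl (fromℕ-mono-≤ (ℕ.>-nonZero⁻¹ q)))))

    -- V n = ∏ (1 - 1/(q j)) over 2 ≤ j ≤ n + 1 is of the order of n ^ (- 1/q),
    -- and V n - V (1 + n) of the order of n ^ (- 1 - 1/q).
    V : ℕ → ℝ
    V zero    = 1#
    V (suc n) = V n * (1# - step n)

    V-pos : ∀ n → 0# < V n
    V-pos zero    = 0<1
    V-pos (suc n) = *-pos (V-pos n) (<⇒0<- (step<1 n))

    V-lower : ∀ n → 1# ≤ V n ^ q * fromℕ (suc n)
    V-lower zero    = ≤-resp (trans (*-identityˡ _) (+-identityʳ 1#)) refl (*-monoʳ-≤ (0≤fromℕ 1) 1≤1^q)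
      where
      1≤1^q : 1# ≤ 1# ^ q
      1≤1^q = ≤-resp (solve 1 (λ Q → :1 :+ Q :* :0 := :1) refl (fromℕ q)) (^-congˡ q (+-identityʳ 1#))
        (bernoulli q (≤-resp refl (sym (+-identityʳ 1#)) (<⇒≤ 0<1)))
    V-lower (suc n) = ≤-trans (V-lower n) (≤-resp
      (≈-modulo (- (V n ^ q)) (recip⁺-inverseʳ (qj-pos n))
        (solve 4 (λ v Q N s → v :* (:1 :+ Q :* :- s) :* (:1 :+ N) :=
            v :* N :+ :- v :* (Q :* (:1 :+ N) :* s :- :1)) refl
          (V n ^ q) (fromℕ q) (fromℕ (suc n)) (step n)))
      (*-congʳ (sym (^-distrib-* (V n) (1# - step n) q)))
      (*-monoʳ-≤ (0≤fromℕ (2 ℕ.+ n)) (*-monoˡ-≤ (^-nonneg q (<⇒≤ (V-pos n)))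
        (bernoulli q (≤⇒0≤- (<⇒≤ (step<1 n)))))))

    -- With s = 1/(q j), (1 - s)(1 + s) ≤ 1 and Bernoulli for (1 + s)^q give (1 - s)^q ≤ j/(j + 1);
    -- the product over 2 ≤ j ≤ n + 1 collapses to 2/(n + 2).
    V-upper : ∀ n → V n ^ q * fromℕ (2 ℕ.+ n) ≤ 2#
    V-upper zero    = ≤-resp refl (solve 0 (:1 :* (:1 :+ (:1 :+ :0)) := :2) refl)
      (*-monoʳ-≤ (0≤fromℕ 2) (1^q≤1 q))
      where
      1^q≤1 : ∀ q → 1# ^ q ≤ 1#
      1^q≤1 zero    = ≤-refl
      1^q≤1 (suc q) = ≤-resp (sym (*-identityˡ _)) refl (1^q≤1 q)
    V-upper (suc n) = ≤-trans
      (≤-resp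
        (≈-modulo (V (suc n) ^ q) (recip⁺-inverseʳ (qj-pos n))
          (solve 4 (λ v Q J s → v :* (J :* (:1 :+ Q :* s)) := v :* (:1 :+ J) :+ v :* (Q :* J :* s :- :1)) refl
            (V (suc n) ^ q) (fromℕ q) (fromℕ (2 ℕ.+ n)) (step n)))
        (solve 3 (λ v J e → v :* (J :* e) := v :* e :* J) refl (V (suc n) ^ q) (fromℕ (2 ℕ.+ n)) ((1# + step n) ^ q))
        (*-monoˡ-≤ (^-nonneg q (<⇒≤ (V-pos (suc n)))) (*-monoˡ-≤ (0≤fromℕ (2 ℕ.+ n))
          (bernoulli q (+-nonneg (<⇒≤ 0<1) (<⇒≤ (step-pos n)))))))
      (≤-trans (*-monoʳ-≤ (0≤fromℕ (2 ℕ.+ n))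
        (≤-resp (^-distrib-* (V (suc n)) (1# + step n) q) refl
          (^-mono-≤ q
            (*-nonneg (<⇒≤ (V-pos (suc n))) (+-nonneg (<⇒≤ 0<1) (<⇒≤ (step-pos n))))
            (0≤-⇒≤ (≤-resp refl
              (solve 2 (λ v s → v :* (s :* s) := v :- v :* (:1 :- s) :* (:1 :+ s)) refl (V n) (step n))
              (*-nonneg (<⇒≤ (V-pos n)) (square-nonneg (step n))))))))
        (V-upper n))

    V⟶0 : V ⟶ᴿ 0#
    V⟶0 = ≼⇒lim λ ε 0<ε →
      let 0<ε^q = ^-pos q 0<ε
          -- Beyond 2 / ε^q, a value V n > ε would make V n ^ q * (n + 2) exceed 2, against
          -- `V-upper`.
          (N , 2/ε^q<N) = archimedean (recip⁺ 0<ε^q * 2#)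
      in N , λ n N≤n → ≼-resp (sym (HCR.x-0≈x (V n))) refl (≼-≤-trans (nonneg⇒≼ (<⇒≤ (V-pos n))) λ ε<V →
        V-upper n (<-≤-trans
          (<-respˡ-≈ (≈-modulo 2# (recip⁺-inverseʳ 0<ε^q)
              (solve 2 (λ e r → e :* (r :* :2) := :2 :+ :2 :* (e :* r :- :1)) refl (ε ^ q) (recip⁺ 0<ε^q)))
            (*-monoˡ-< 0<ε^q (<-≤-trans 2/ε^q<N (fromℕ-mono-≤ (ℕ.≤-trans N≤n (ℕ.m≤n+m n 2))))))
          (*-monoʳ-≤ (0≤fromℕ (2 ℕ.+ n)) (^-mono-≤ q (<⇒≤ 0<ε) (<⇒≤ ε<V)))))

    g : ℕ → ℝ
    g n = V n - V (suc n)

    g-pos : ∀ n → 0# < g n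
    g-pos n = <-respʳ-≈ (solve 2 (λ v s → v :* s :=
        v :- v :* (:1 :- s)) refl (V n) (step n)) (*-pos (V-pos n) (step-pos n))

    g-sum : ∑₀ g ⟶ᴿ 1#
    g-sum = lim-cong telescope (HCR.x-0≈x 1#) (lim-+ (lim-const {1#}) (lim-neg V⟶0))
      where
      telescope : ∀ N → 1# - V N ≈ ∑₀ g N
      telescope zero    = -‿inverseʳ 1#
      telescope (suc N) = trans (solve 3 (λ o v w → o :- w :=
          o :- v :+ (v :- w)) refl 1# (V N) (V (suc N))) (+-congʳ (telescope N))

    -- For k = n + 1 this is k^e ≤ k^(1 - 1/q) ≤ k * V n, compared through q-th powers: `below`
    -- gives k * y ^ q ≤ k ^ q, while `V-lower` gives k ^ q ≤ k * (k * V n) ^ q.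
    power≤ : ∀ {n e y} → 1# + fromℕ q * e ≤ fromℕ q → IsPower (suc n) e y → y ≤ fromℕ (suc n) * V n
    power≤ {n} {e} {y} 1+qe≤q isPower kV<y = IsPower.below isPower q 1 q
      (≤-resp (+-congʳ (sym (+-identityʳ 1#))) refl 1+qe≤q)
      (≤-<-trans
        (≤-resp (*-identityʳ _) (solve 3 (λ K v k → K :* (v :* k) := k :* (K :* v)) refl (k ^ q) (V n ^ q) k)
          (*-monoˡ-≤ (^-nonneg q (0≤fromℕ (suc n))) (V-lower n)))
        (<-respʳ-≈ (*-congʳ (sym (*-identityʳ k))) (*-monoˡ-< (0<fromℕ (suc n))
          (<-respˡ-≈ (^-distrib-* k (V n) q)
            (^-mono-< q (*-nonneg (0≤fromℕ (suc n)) (<⇒≤ (V-pos n))) kV<y)))))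
      where k = fromℕ (suc n)

    -- For k = n + 1, the left side is at most V n / k, whereas `g n` is V n / (q (k + 1)). The
    -- factor 2 q pays for q and for k + 1 ≤ 2 k.
    power/k²≤ : ∀ {n e y} → 1# + fromℕ q * e ≤ fromℕ q → IsPower (suc n) e y → y * 1/k² n ≤ 2# * fromℕ q * g n
    power/k²≤ {n} {e} {y} 1+qe≤q isPower = *-cancelˡ-≤ (fromℕ²-pos n) (≤-trans
      (≤-resp (≈-modulo (- y) (recip⁺-inverseʳ (fromℕ²-pos n))
                (solve 3 (λ y k κ → y := k :^ 2 :* (y :* κ) :+ :- y :* (k :^ 2 :* κ :- :1)) refl y k (1/k² n)))
              refl (power≤ 1+qe≤q isPower))
      (0≤-⇒≤ (≤-resp refl
        (≈-modulo (- (k * V n)) (recip⁺-inverseʳ (qj-pos n))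
          (solve 4 (λ k v s Q → k :* v :* s :* Q :* (k :- :1) :=
              k :^ 2 :* (:2 :* Q :* (v :- v :* (:1 :- s))) :- k :* v :+ :- (k :* v) :* (Q :* (:1 :+ k) :* s :- :1))
            refl k (V n) (step n) (fromℕ q)))
        (*-nonneg (*-nonneg (*-nonneg (*-nonneg (0≤fromℕ (suc n)) (<⇒≤ (V-pos n))) (<⇒≤ (step-pos n))) (0≤fromℕ q))
          (≤⇒0≤- (≤-resp (+-identityʳ 1#) refl (fromℕ-mono-≤ {1} {suc n} (ℕ.s≤s ℕ.z≤n))))))))
      where k = fromℕ (suc n)

  -- Every q above 1/(1 - e) serves, as it puts e below 1 - 1/q.
  1+q*e≤q : ∀ {e} → e < 1# → ∃[ q ] (NonZero q × 1# + fromℕ q * e ≤ fromℕ q)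
  1+q*e≤q {e} e<1 with archimedean (recip⁺ (<⇒0<- e<1))
  ... | zero    , r<0 = ⊥-elim (<⇒≤ (recip⁺-pos (<⇒0<- e<1)) r<0)
  ... | suc n   , r<q = suc n , _ , 0≤-⇒≤ (≤-resp refl
    (≈-modulo (- 1#) (recip⁺-inverseʳ 0<1-e)
      (solve 3 (λ e q r → (:1 :- e) :* (q :- r) := q :- (:1 :+ q :* e) :+ :- :1 :* ((:1 :- e) :* r :- :1)) refl
        e (fromℕ (suc n)) (recip⁺ 0<1-e)))
    (*-nonneg (<⇒≤ 0<1-e) (≤⇒0≤- (<⇒≤ r<q))))
    where
    0<1-e : 0# < 1# - e
    0<1-e = <⇒0<- e<1

  -- From the growth condition to convergent majorants

  ∣∣≤⇒re≼ : ∀ {z r} → ∣ z ∣≤ r → re z ≼ r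
  ∣∣≤⇒re≼ {z} (0≤r , zz≤rr) = square-≤⇒≼ 0≤r (≤-trans
    (≤-resp (+-identityʳ _) refl (+-mono-≤ ≤-refl (square-nonneg (im z)))) zz≤rr)

  ∣∣≤⇒im≼ : ∀ {z r} → ∣ z ∣≤ r → im z ≼ r
  ∣∣≤⇒im≼ {z} (0≤r , zz≤rr) = square-≤⇒≼ 0≤r (≤-trans
    (≤-resp (+-identityˡ _) refl (+-mono-≤ (square-nonneg (re z)) ≤-refl)) zz≤rr)

  -- Σ ∣ x k ∣ / k² converges, where x k is stored at index k - 1, as in all real
  -- sequences below.
  Admissible : (ℕ → ℝ) → Set (c ⊔ ℓ₂)
  Admissible x = ∃[ g ] ∃[ G ] ∑₀ g ⟶ᴿ G × (∀ n → x n * 1/k² n ≼ g n)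

  module _ (q : ℕ) {{_ : NonZero q}} where
    open Majorant q

    -- Dividing by `g n`, which is positive, turns the eventual estimate into a bounded sequence.
    -- The initial terms then only enlarge the constant.
    majorized⇒admissible : ∀ {x : ℕ → ℝ} {C} N → (∀ n → N ℕ.≤ n → x n * 1/k² n ≼ C * g n) → Admissible x
    majorized⇒admissible {x} {C} N x≼Cg =
      (λ n → D * g n) , D * 1# , lim-cong (λ N → sym (∑₀-scale D g N)) refl (lim-scale D g-sum) ,
      λ n → ≼-resp
        (≈-modulo (x/k² n) (recip⁺-inverseʳ (g-pos n))
          (solve 3 (λ x g h → x :* h :* g := x :+ x :* (g :* h :- :1)) refl (x/k² n) (g n) (1/g n)))
        refl (≼-* (proj₂ bounded n) (nonneg⇒≼ (<⇒≤ (g-pos n))))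
      where
      x/k² 1/g : ℕ → ℝ
      x/k² n = x n * 1/k² n
      1/g n = recip⁺ (g-pos n)
      bound : ∀ n → N ℕ.≤ n → x/k² n * 1/g n ≼ C
      bound n N≤n = ≼-resp refl
        (≈-modulo C (recip⁺-inverseʳ (g-pos n))
          (solve 3 (λ C g h → C :* g :* h := C :+ C :* (g :* h :- :1)) refl C (g n) (1/g n)))
        (≼-* (x≼Cg n N≤n) (nonneg⇒≼ (<⇒≤ (recip⁺-pos (g-pos n)))))
      bounded : ∃[ D ] (∀ n → x/k² n * 1/g n ≼ D)
      bounded = eventually≼⇒≼ (λ n → x/k² n * 1/g n) N bound
      D : ℝ
      D = proj₁ bounded

  isℴ⇒admissible : ∀ {A e} (f : ℂ → ℝ) → (∀ {z r} → ∣ z ∣≤ r → f z ≼ r) → e < 1# → A isℴ e →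
                   Admissible (λ n → f (A (ℤ.+ suc n)))
  isℴ⇒admissible {A} {e} f f≼ e<1 Aℴ =
    let (q , q≢0 , 1+qe≤q) = 1+q*e≤q e<1
        -- With ε = 1 the little o reads ∣A k∣ ≤ ∣k∣^e beyond N; here k = n + 1, so n ≥ N suffices.
        (N , small) = Aℴ 1# 0<1
        instance _ = q≢0
    in majorized⇒admissible q {C = 2# * fromℕ q} N λ n N≤n →
         let (y , isPower , A≤y) = small (ℤ.+ suc n) (ℕ.s≤s N≤n) in
         ≼-≤-trans (≼-* (≼-resp refl (*-identityˡ y) (f≼ A≤y)) (nonneg⇒≼ (<⇒≤ (recip⁺-pos (fromℕ²-pos n)))))
                   (Majorant.power/k²≤ q 1+qe≤q isPower)

  -- Series of an admissible sequence against multipliers of order 1/k²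

  majorant : ∀ {x} → Admissible x → ℝ → ℕ → ℝ
  majorant (g , _) C n = g n * C

  total : ∀ {x} → Admissible x → ℝ → ℝ
  total (_ , G , _) C = G * C

  -- It depends on a multiplier only through the constant C. One null sequence therefore bounds the
  -- tails of a whole family of series whose multipliers share that constant.
  remainder : ∀ {x} → Admissible x → ℝ → ℕ → ℝ
  remainder adm C N = total adm C - ∑₀ (majorant adm C) N

  majorant-lim : ∀ {x} (adm : Admissible x) C → ∑₀ (majorant adm C) ⟶ᴿ total adm C
  majorant-lim (g , G , g⟶G , _) C = lim-cong
    (λ N → trans (sym (∑₀-scale C g N)) (∑₀-cong (λ n → *-comm C (g n)) N)) (*-comm C G) (lim-scale C g⟶G)

  remainder⟶0 : ∀ {x} (adm : Admissible x) C → remainder adm C ⟶ᴿ 0#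
  remainder⟶0 adm C = lim-cong (λ _ →
      refl) (-‿inverseʳ _) (lim-+ (lim-const {total adm C}) (lim-neg (majorant-lim adm C)))

  Multiplier : (ℕ → ℝ) → ℝ → Set ℓ₂
  Multiplier y C = ∀ n → y n * fromℕ (suc n) ^ 2 ≼ C

  product≼majorant : ∀ {x y C} (adm : Admissible x) → Multiplier y C → ∀ n → x n * y n ≼ majorant adm C n
  product≼majorant {x} {y} (g , G , _ , x≼g) y≼C n = ≼-resp
    (≈-modulo (x n * y n) (recip⁺-inverseʳ (fromℕ²-pos n))
      (solve 4 (λ x y k κ → x :* κ :* (y :* k :^ 2) := x :* y :+ x :* y :* (k :^ 2 :* κ :- :1)) refl
        (x n) (y n) (fromℕ (suc n)) (1/k² n)))
    refl (≼-* (x≼g n) (y≼C n))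

  series : ∀ {x y C} (adm : Admissible x) → Multiplier y C →
           ∃[ L ] ∑₀ (λ n → x n * y n) ⟶ᴿ L × (∀ N → L - ∑₀ (λ n → x n * y n) N ≼ remainder adm C N)
  series {C = C} adm y≼C = comparison (product≼majorant adm y≼C) (majorant-lim adm C)

  ∑₀-*-≼ : ∀ {x p y : ℕ → ℝ} {t} → (∀ n → x n ≼ p n) → (∀ n → y n ≼ t) → ∀ N → ∑₀ (λ n → x n * y n) N ≼ t * ∑₀ p N
  ∑₀-*-≼ {p = p} {t = t} x≼p y≼t N = ≼-resp refl (∑₀-scale t p N)
    (∑₀-≼ (λ n → ≼-resp refl (*-comm (p n) t) (≼-* (x≼p n) (y≼t n))) N)

  -- The inner errors `z n N` have a bound independent of n, which comes out of the sum. What is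
  -- left is dominated by a convergent series, hence bounded, and the remainder tends to 0.
  ∑₀-*-remainder⟶0 : ∀ {x u} (admᵤ : Admissible u) (admₓ : Admissible x) {y : ℕ → ℝ} {z : ℕ → ℕ → ℝ} {C D} →
    Multiplier y C → (∀ n N → z n N ≼ remainder admᵤ D N) → (λ N → ∑₀ (λ n → x n * y n * z n N) N) ⟶ᴿ 0#
  ∑₀-*-remainder⟶0 admᵤ admₓ {C = C} {D} y≼C z≼ = squeeze
    (λ N → ∑₀-*-≼ (product≼majorant admₓ y≼C) (λ n → z≼ n N) N)
    (lim-null-* (remainder⟶0 admᵤ D) λ N →
      ≼-≤-trans (nonneg⇒≼ (≼⇒0≤ (∑₀-≼ (product≼majorant admₓ y≼C) N)))
        (∑₀≤limit (λ n → ≼⇒0≤ (product≼majorant admₓ y≼C n)) (majorant-lim admₓ C) N))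

  -- Dropping p from p + z u bounds z / (p + z u) by 1 / u; the gap is exactly v p s. This is the
  -- source of the bounds for `ρ`, `h` and, up to sign, `r`.
  inverse-of-sum-≼ : ∀ {p z u v s} → (p + z * u) * s ≈ 1# → u * v ≈ 1# → 0# ≤ p → 0# ≤ z → 0# ≤ v → 0# ≤ s → s * z ≼ v
  inverse-of-sum-≼ {p} {z} {u} {v} {s} inv uv≈1 0≤p 0≤z 0≤v 0≤s = ≼-≤-trans (nonneg⇒≼
      (*-nonneg 0≤s 0≤z)) (0≤-⇒≤ (≤-resp refl
    (≈-modulo v inv (≈-modulo (- (s * z)) uv≈1
      (solve 5 (λ p z u v s → v :* p :* s :=
          v :- s :* z :+ v :* ((p :+ z :* u) :* s :- :1) :+ :- (s :* z) :* (u :* v :- :1))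
        refl p z u v s)))
    (*-nonneg (*-nonneg 0≤v 0≤p) 0≤s)))

  -- Complex series and quotients

  component-lim : ∀ {z L} → (λ n → re (z n)) ⟶ᴿ re L → (λ n → im (z n)) ⟶ᴿ im L → z ⟶ L
  component-lim {z} {L} re⟶ im⟶ ε 0<ε =
    let (N₁ , h₁) = lim⇒≼ re⟶ (half ε) (half-pos 0<ε)
        (N₂ , h₂) = lim⇒≼ im⟶ (half ε) (half-pos 0<ε)
    in N₁ ℕ.⊔ N₂ , λ n N≤n → <⇒≤ 0<ε , ≤-trans
         (+-mono-≤ (square≤ (h₁ n (ℕ.≤-trans (ℕ.m≤m⊔n N₁ N₂) N≤n))) (square≤ (h₂ n (ℕ.≤-trans (ℕ.m≤n⊔m N₁ N₂) N≤n))))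
         (≤-resp refl (*-cong (half+half ε) (half+half ε)) (0≤-⇒≤ (≤-resp refl
           (solve 1 (λ h → h :* h :+ h :* h := (h :+ h) :* (h :+ h) :- (h :* h :+ h :* h)) refl (half ε))
           (+-nonneg (square-nonneg (half ε)) (square-nonneg (half ε))))))
    where
    square≤ : ∀ {x y} → x ≼ y → x * x ≤ y * y
    square≤ x≼y = *-≼-≤ x≼y x≼y

  re-lim : ∀ {z L} → z ⟶ L → (λ n → re (z n)) ⟶ᴿ re L
  re-lim z⟶L = ≼⇒lim λ ε 0<ε → let (N , h) = z⟶L ε 0<ε in N , λ n N≤n → ∣∣≤⇒re≼ (h n N≤n)

  im-lim : ∀ {z L} → z ⟶ L → (λ n → im (z n)) ⟶ᴿ im L
  im-lim z⟶L = ≼⇒lim λ ε 0<ε → let (N , h) = z⟶L ε 0<ε in N , λ n N≤n → ∣∣≤⇒im≼ (h n N≤n)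

  re-∑ : ∀ (f : Terms) {x : ℕ → ℝ} → (∀ n → re (f (suc n)) ≈ x n) → ∀ N → re (∑ f N) ≈ ∑₀ x N
  re-∑ f f≈x zero    = refl
  re-∑ f f≈x (suc N) = +-cong (re-∑ f f≈x N) (f≈x N)

  im-∑ : ∀ (f : Terms) {x : ℕ → ℝ} → (∀ n → im (f (suc n)) ≈ x n) → ∀ N → im (∑ f N) ≈ ∑₀ x N
  im-∑ f f≈x zero    = refl
  im-∑ f f≈x (suc N) = +-cong (im-∑ f f≈x N) (f≈x N)

  component-sum : ∀ {f : Terms} {x y : ℕ → ℝ} {S : ℂ} → (∀ n → re (f (suc n)) ≈ x n) → (∀ n → im (f (suc n)) ≈ y n) →
                  ∑₀ x ⟶ᴿ re S → ∑₀ y ⟶ᴿ im S → HasSum f S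
  component-sum {f} re≈ im≈ x⟶ y⟶ = component-lim
    (lim-cong (λ N → sym (re-∑ f re≈ N)) refl x⟶) (lim-cong (λ N → sym (im-∑ f im≈ N)) refl y⟶)

  -- Trades the reciprocal of `normSq u` hidden in a complex quotient for a reciprocal y of the real
  -- number u that is already at hand.
  /ᶜ-real : ∀ z u {y} (u≢0 : u ≢0) → re u * y ≈ 1# → im u ≈ 0# →
            re (z /ᶜ u [ u≢0 ]) ≈ re z * y × im (z /ᶜ u [ u≢0 ]) ≈ im z * y
  /ᶜ-real z u {y} u≢0 cy≈1 d≈0 =
    ≈-modulo (- (n * re z * re u)) cy≈1 (≈-modulo (n * im z - re z * y * im u * n) d≈0 (≈-modulo (re z * y) N*n≈1
      (solve 6 (λ a b c d y n → n :* (a :* c :- b :* :- d) := a :* y :+ :- (n :* a :* c) :* (c :* y :- :1)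
         :+ (n :* b :- a :* y :* d :* n) :* (d :- :0) :+ a :* y :* ((c :* c
             :+ d :* d) :* n :- :1)) refl (re z) (im z) (re u) (im u) y n))) ,
    ≈-modulo (- (n * im z * re u)) cy≈1 (≈-modulo (- (n * re z) - im z * y * im u * n) d≈0 (≈-modulo (im z * y) N*n≈1
      (solve 6 (λ a b c d y n → n :* (a :* :- d :+ b :* c) := b :* y :+ :- (n :* b :* c) :* (c :* y :- :1)
         :+ (:- (n :* a) :- b :* y :* d :* n) :* (d :- :0) :+ b :* y :* ((c :* c
             :+ d :* d) :* n :- :1)) refl (re z) (im z) (re u) (im u) y n)))
    where
    n = recip⁺ u≢0
    N*n≈1 : normSq u * n ≈ 1#
    N*n≈1 = recip⁺-inverseʳ u≢0

  /ᶜ-imaginary : ∀ z u {y} (u≢0 : u ≢0) → re u ≈ 0# → im u * y ≈ 1# →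
                 re (z /ᶜ u [ u≢0 ]) ≈ im z * y × im (z /ᶜ u [ u≢0 ]) ≈ - (re z * y)
  /ᶜ-imaginary z u {y} u≢0 c≈0 dy≈1 =
    ≈-modulo (- (n * im z * im u)) dy≈1 (≈-modulo (n * re z - im z * y * re u * n) c≈0 (≈-modulo (im z * y) N*n≈1
      (solve 6 (λ a b c d y n → n :* (a :* c :- b :* :- d) := b :* y :+ :- (n :* b :* d) :* (d :* y :- :1)
         :+ (n :* a :- b :* y :* c :* n) :* (c :- :0) :+ b :* y :* ((c :* c
             :+ d :* d) :* n :- :1)) refl (re z) (im z) (re u) (im u) y n))) ,
    ≈-modulo (n * re z * im u) dy≈1 (≈-modulo (n * im z + re z * y * re u * n) c≈0 (≈-modulo (- (re z * y)) N*n≈1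
      (solve 6 (λ a b c d y n → n :* (a :* :- d :+ b :* c) := :- (a :* y) :+ n :* a :* d :* (d :* y :- :1)
         :+ (n :* b :+ a :* y :* c :* n) :* (c :- :0) :+ :- (a :* y) :* ((c :* c
             :+ d :* d) :* n :- :1)) refl (re z) (im z) (re u) (im u) y n)))
    where
    n = recip⁺ u≢0
    N*n≈1 : normSq u * n ≈ 1#
    N*n≈1 = recip⁺-inverseʳ u≢0

  square-pos : ∀ {x y} → x * y ≈ 1# → 0# < x * x
  square-pos {x} {y} xy≈1 with #⇒<⊎> (HCR.invertibleʳ⇒# (y , trans (*-congʳ (HCR.x-0≈x x)) xy≈1))
  ... | inj₁ x<0 = <-respʳ-≈ (solve 1 (λ x → (:0 :- x) :* (:0 :- x) := x :* x) refl x) (*-pos (<⇒0<- x<0) (<⇒0<- x<0))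
  ... | inj₂ 0<x = *-pos 0<x 0<x

  ≢0-re : ∀ {u y} → re u * y ≈ 1# → u ≢0
  ≢0-re {u} cy≈1 = <-≤-trans (square-pos cy≈1) (≤-resp (+-identityʳ _) refl (+-mono-≤ ≤-refl (square-nonneg (im u))))

  ≢0-im : ∀ {u y} → im u * y ≈ 1# → u ≢0
  ≢0-im {u} dy≈1 = <-≤-trans (square-pos dy≈1) (≤-resp (+-identityˡ _) refl (+-mono-≤ (square-nonneg (re u)) ≤-refl))

  -- The real sequences start at k = 1 with index 0, so facts are available at successors only; the
  -- zero case is refuted by its irrelevant instance.
  nonZero-cases : ∀ {p} {P : ∀ k → .{{NonZero k}} → Set p} → (∀ n → P (suc n)) → ∀ k .{{_ : NonZero k}} → P k
  nonZero-cases P-suc zero {{nz}} = ⊥-elim-irr (ℕ.≢-nonZero⁻¹ 0 {{nz}} ≡.refl)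
  nonZero-cases P-suc (suc n)     = P-suc n

  -- Values of cot and coth at real arguments

  module Cotangent (π : ℝ) (0<π : 0# < π) where

    1/π : ℝ
    1/π = recip⁺ 0<π

    π*1/π≈1 : π * 1/π ≈ 1#
    π*1/π≈1 = recip⁺-inverseʳ 0<π

    -- Here π s = t forces s = t/π, and dividing `value` by π turns 2 s S into 2 (t/π²) S. The
    -- reciprocals `y` of k² - s² are a parameter, so that series already summed in another form can
    -- be supplied.
    isCot : ∀ {A : ℤ → ℂ} {t t′ : ℝ} {v S : ℂ} {y : ℕ → ℝ} → t * t′ ≈ 1# →
      (∀ n → (fromℕ (suc n) ^ 2 - 1/π * t * (1/π * t)) * y n ≈ 1#) →
      ∑₀ (λ n → re (A (ℤ.+ suc n)) * y n) ⟶ᴿ re S → ∑₀ (λ n → im (A (ℤ.+ suc n)) * y n) ⟶ᴿ im S →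
      re v ≈ t′ * re (A (ℤ.+ 0)) - 2# * (t * (1/π * 1/π)) * re S →
      im v ≈ t′ * im (A (ℤ.+ 0)) - 2# * (t * (1/π * 1/π)) * im S →
      IsCot π A (ι t) v
    isCot {A} {t} {t′} {v} {S} {y} tt′≈1 inv re⟶ im⟶ re-v im-v = record
      { s = s
      ; πs≈z = ≈-modulo t π*1/π≈1 (solve 3 (λ p q t → p :* (q :* t) :=
          t :+ t :* (p :* q :- :1)) refl π 1/π t) , zeroʳ π
      ; s≢0 = s≢0
      ; k²-s²≢0 = d≢0
      ; S = S
      ; hasSum = component-sum
          (λ n → proj₁ (/ᶜ-real (A (ℤ.+ suc n)) (d (suc n)) (d≢0 (suc n)) (d-inv n) d-im))
          (λ n → proj₂ (/ᶜ-real (A (ℤ.+ suc n)) (d (suc n)) (d≢0 (suc n)) (d-inv n) d-im))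
          re⟶ im⟶
      ; value =
          trans (*-congˡ re-v) (trans (part (re S) (re (A (ℤ.+ 0))))
            (+-cong (sym (proj₁ a₀/s)) (-‿cong (*-congˡ (solve 3 (λ s x y → s :* x :=
                s :* x :- :0 :* y) refl (1/π * t) (re S) (im S)))))) ,
          trans (*-congˡ im-v) (trans (part (im S) (im (A (ℤ.+ 0))))
            (+-cong (sym (proj₂ a₀/s)) (-‿cong (*-congˡ (solve 3 (λ s x y → s :* y :=
                s :* y :+ :0 :* x) refl (1/π * t) (re S) (im S))))))
      }
      where
      s : ℂ
      s = ι (1/π * t)
      d : ℕ → ℂ
      d k = ι (fromℕ k ^ 2) -ᶜ s *ᶜ s
      s-inv : re s * (π * t′) ≈ 1#
      s-inv = ≈-modulo (t * t′) π*1/π≈1 (≈-modulo 1# tt′≈1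
        (solve 4 (λ p q t u → q :* t :* (p :* u) :=
            :1 :+ t :* u :* (p :* q :- :1) :+ :1 :* (t :* u :- :1)) refl π 1/π t t′))
      s≢0 : s ≢0
      s≢0 = ≢0-re s-inv
      d-inv : ∀ n → re (d (suc n)) * y n ≈ 1#
      d-inv n = trans (*-congʳ (solve 2 (λ K s → K :- (s :* s :- :0 :* :0) :=
          K :- s :* s) refl (fromℕ (suc n) ^ 2) (1/π * t))) (inv n)
      d-im : 0# - (1/π * t * 0# + 0# * (1/π * t)) ≈ 0#
      d-im = solve 1 (λ s → :0 :- (s :* :0 :+ :0 :* s) := :0) refl (1/π * t)
      d≢0 : ∀ k .{{_ : NonZero k}} → d k ≢0
      d≢0 = nonZero-cases (λ n → ≢0-re (d-inv n))
      a₀/s = /ᶜ-real (A (ℤ.+ 0)) s s≢0 s-inv refl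
      part : ∀ S a → π * (t′ * a - 2# * (t * (1/π * 1/π)) * S) ≈ a * (π * t′) - 2# * (1/π * t * S)
      part S a = ≈-modulo (- (2# * t * 1/π * S)) π*1/π≈1
        (solve 6 (λ S a p q t u → p :* (u :* a :- :2 :* (t :* (q :* q)) :* S) :=
            a :* (p :* u) :- :2 :* (q :* t :* S) :+ :- (:2 :* t :* q :* S) :* (p :* q :- :1)) refl S a π 1/π t t′)

    isCoth : ∀ {A : ℤ → ℂ} {t t′ : ℝ} {v S : ℂ} {y : ℕ → ℝ} → t * t′ ≈ 1# →
      (∀ n → (fromℕ (suc n) ^ 2 + 1/π * t * (1/π * t)) * y n ≈ 1#) →
      ∑₀ (λ n → re (A (ℤ.+ suc n)) * y n) ⟶ᴿ re S → ∑₀ (λ n → im (A (ℤ.+ suc n)) * y n) ⟶ᴿ im S →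
      re v ≈ t′ * re (A (ℤ.+ 0)) + 2# * (t * (1/π * 1/π)) * re S →
      im v ≈ t′ * im (A (ℤ.+ 0)) + 2# * (t * (1/π * 1/π)) * im S →
      IsCoth π A (ι t) v
    -- From v = i u the cotangent at i t is u = -i v. The point s = i t/π makes -s² a square of a
    -- real number, so k² - s² is real and positive.
    isCoth {A} {t} {t′} {v} {S} {y} tt′≈1 inv re⟶ im⟶ re-v im-v = (im v +i (- re v)) , record
      { s = s
      ; πs≈z = solve 2 (λ p t → p :* :0 := :0 :* t :- :1 :* :0) refl π t
             , ≈-modulo t π*1/π≈1 (solve 3 (λ p q t → p :* (q :* t) :=
                 :0 :* :0 :+ :1 :* t :+ t :* (p :* q :- :1)) refl π 1/π t)
      ; s≢0 = s≢0
      ; k²-s²≢0 = d≢0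
      ; S = S
      ; hasSum = component-sum
          (λ n → proj₁ (/ᶜ-real (A (ℤ.+ suc n)) (d (suc n)) (d≢0 (suc n)) (d-inv n) d-im))
          (λ n → proj₂ (/ᶜ-real (A (ℤ.+ suc n)) (d (suc n)) (d≢0 (suc n)) (d-inv n) d-im))
          re⟶ im⟶
      ; value =
          trans (*-congˡ im-v) (trans (part (im S) (im (A (ℤ.+ 0))))
            (+-cong (sym (proj₁ a₀/s)) (solve 3 (λ s x y → :2 :* (s :* y) :=
                :- (:2 :* (:0 :* x :- s :* y))) refl (1/π * t) (re S) (im S)))) ,
          trans (*-congˡ (-‿cong re-v)) (trans
              (sym (RP.-‿distribʳ-* π _)) (trans (-‿cong (part (re S) (re (A (ℤ.+ 0)))))
            (trans (sym (AG.⁻¹-∙-comm _ _)) (+-cong (sym (proj₂ a₀/s))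
              (-‿cong (*-congˡ (solve 3 (λ s x y → s :* x := :0 :* y :+ s :* x) refl (1/π * t) (re S) (im S))))))))
      } , (solve 2 (λ x y → x := :0 :* y :- :1 :* :- x) refl (re v) (im v)
          , solve 2 (λ x y → y := :0 :* :- x :+ :1 :* y) refl (re v) (im v))
      where
      s : ℂ
      s = 0# +i (1/π * t)
      d : ℕ → ℂ
      d k = ι (fromℕ k ^ 2) -ᶜ s *ᶜ s
      s-inv : im s * (π * t′) ≈ 1#
      s-inv = ≈-modulo (t * t′) π*1/π≈1 (≈-modulo 1# tt′≈1
        (solve 4 (λ p q t u → q :* t :* (p :* u) :=
            :1 :+ t :* u :* (p :* q :- :1) :+ :1 :* (t :* u :- :1)) refl π 1/π t t′))
      s≢0 : s ≢0
      s≢0 = ≢0-im {s} s-inv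
      d-inv : ∀ n → re (d (suc n)) * y n ≈ 1#
      d-inv n = trans (*-congʳ (solve 2 (λ K s → K :- (:0 :* :0 :- s :* s) :=
          K :+ s :* s) refl (fromℕ (suc n) ^ 2) (1/π * t))) (inv n)
      d-im : 0# - (0# * (1/π * t) + 1/π * t * 0#) ≈ 0#
      d-im = solve 1 (λ s → :0 :- (:0 :* s :+ s :* :0) := :0) refl (1/π * t)
      d≢0 : ∀ k .{{_ : NonZero k}} → d k ≢0
      d≢0 = nonZero-cases (λ n → ≢0-re (d-inv n))
      a₀/s = /ᶜ-imaginary (A (ℤ.+ 0)) s s≢0 refl s-inv
      part : ∀ S a → π * (t′ * a + 2# * (t * (1/π * 1/π)) * S) ≈ a * (π * t′) + 2# * (1/π * t * S)
      part S a = ≈-modulo (2# * t * 1/π * S) π*1/π≈1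
        (solve 6 (λ S a p q t u → p :* (u :* a :+ :2 :* (t :* (q :* q)) :* S) :=
            a :* (p :* u) :+ :2 :* (q :* t :* S) :+ :2 :* t :* q :* S :* (p :* q :- :1)) refl S a π 1/π t t′)

  -- The identity for real sequences

  module Setting (π α β w : ℝ) (0<π : 0# < π) (0<α : 0# < α) (0<β : 0# < β) (αβ≈π² : α * β ≈ π ^ 2) (0<w : 0# < w)
                 (w#n²β : ∀ n .{{_ : NonZero n}} → w # fromℕ n ^ 2 * β) where

    k : ℕ → ℝ
    k n = fromℕ (suc n)

    k-pos : ∀ n → 0# < k n
    k-pos n = 0<fromℕ (suc n)

    1/k 1/kα 1/kβ r ρ : ℕ → ℝ
    1/k n = recip (fromℕ#0 (suc n))
    1/kα n = recip⁺ (*-pos (k-pos n) 0<α)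
    1/kβ n = recip⁺ (*-pos (k-pos n) 0<β)
    r n = recip (#⇒-#0 (w#n²β (suc n)))
    ρ n = recip⁺ (+-pos 0<w (*-pos (fromℕ²-pos n) 0<α))

    1/α 1/β : ℝ
    1/α = recip⁺ 0<α
    1/β = recip⁺ 0<β

    h-pos : ∀ m n → 0# < k m ^ 2 * β + k n ^ 2 * α
    h-pos m n = +-pos (*-pos (fromℕ²-pos m) 0<β) (*-pos (fromℕ²-pos n) 0<α)

    h : ℕ → ℕ → ℝ
    h m n = recip⁺ (h-pos m n)

    r-inverse : ∀ n → (w - k n ^ 2 * β) * r n ≈ 1#
    r-inverse n = recip-inverseʳ (#⇒-#0 (w#n²β (suc n)))

    ρ-inverse : ∀ n → (w + k n ^ 2 * α) * ρ n ≈ 1#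
    ρ-inverse n = recip⁺-inverseʳ (+-pos 0<w (*-pos (fromℕ²-pos n) 0<α))

    h-inverse : ∀ m n → (k m ^ 2 * β + k n ^ 2 * α) * h m n ≈ 1#
    h-inverse m n = recip⁺-inverseʳ (h-pos m n)

    1/k²-multiplier : Multiplier 1/k² 1#
    1/k²-multiplier n = ≼-resp (trans (sym (recip⁺-inverseʳ (fromℕ²-pos n))) (*-comm _ _)) refl (nonneg⇒≼ (<⇒≤ 0<1))

    ρ-multiplier : Multiplier ρ 1/α
    ρ-multiplier n = inverse-of-sum-≼ (ρ-inverse n) (recip⁺-inverseʳ 0<α) (<⇒≤ 0<w) (<⇒≤ (fromℕ²-pos n))
      (<⇒≤ (recip⁺-pos 0<α)) (<⇒≤ (recip⁺-pos (+-pos 0<w (*-pos (fromℕ²-pos n) 0<α))))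

    h-multiplierʳ : ∀ m → Multiplier (h m) 1/α
    h-multiplierʳ m n = inverse-of-sum-≼ (h-inverse m n) (recip⁺-inverseʳ 0<α) (<⇒≤ (*-pos (fromℕ²-pos m) 0<β))
      (<⇒≤ (fromℕ²-pos n)) (<⇒≤ (recip⁺-pos 0<α)) (<⇒≤ (recip⁺-pos (h-pos m n)))

    h-multiplierˡ : ∀ n → Multiplier (λ m → h m n) 1/β
    h-multiplierˡ n m = inverse-of-sum-≼ (trans (*-congʳ (+-comm _ _)) (h-inverse m n)) (recip⁺-inverseʳ 0<β)
      (<⇒≤ (*-pos (fromℕ²-pos n) 0<α)) (<⇒≤ (fromℕ²-pos m)) (<⇒≤ (recip⁺-pos 0<β)) (<⇒≤ (recip⁺-pos (h-pos m n)))

    -- Once k² β/2 ≥ w, the splitting k² β - w = (k² β/2 - w) + k² β/2 bounds -r k² by 2/β. The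
    -- earlier terms may have either sign and are merely bounded.
    r-multiplier : ∃[ C ] Multiplier r C
    r-multiplier = eventually≼⇒≼ (λ n → r n * k n ^ 2) N bound
      where
      β/2 = half β
      0<β/2 = half-pos 0<β
      -- From k ≥ N > 2 w/β and k² ≥ k follows k² β/2 ≥ w.
      N = proj₁ (archimedean (recip⁺ 0<β/2 * w))
      w≤k²β/2 : ∀ n → N ℕ.≤ n → w ≤ k n ^ 2 * β/2
      w≤k²β/2 n N≤n = ≤-trans
        (≤-resp (≈-modulo w (recip⁺-inverseʳ 0<β/2) (solve 3 (λ w b c → b :* (c :* w) :=
            w :+ w :* (b :* c :- :1)) refl w β/2 (recip⁺ 0<β/2)))
          (solve 2 (λ b K → b :* K := K :* :1 :* b) refl β/2 (k n))
          (*-monoˡ-≤ (<⇒≤ 0<β/2) (≤-trans (<⇒≤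
              (proj₂ (archimedean (recip⁺ 0<β/2 * w)))) (fromℕ-mono-≤ (ℕ.≤-trans N≤n (ℕ.n≤1+n n))))))
        (*-monoʳ-≤ (<⇒≤ 0<β/2) (*-monoˡ-≤ (<⇒≤ (k-pos n)) (≤-resp (+-identityʳ 1#)
            (sym (*-identityʳ (k n))) (fromℕ-mono-≤ {1} {suc n} (ℕ.s≤s ℕ.z≤n)))))
      bound : ∀ n → N ℕ.≤ n → r n * k n ^ 2 ≼ recip⁺ 0<β/2
      bound n N≤n = ≼-resp (solve 2 (λ r K → :- (:- r :* K) := r :* K) refl (r n) (k n ^ 2)) refl
        (≼-neg (inverse-of-sum-≼ inv (recip⁺-inverseʳ 0<β/2) 0≤p
          (<⇒≤ (fromℕ²-pos n)) (<⇒≤ (recip⁺-pos 0<β/2)) (<⇒≤ (inverse-pos inv 0<p+k²β/2))))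
        where
        0≤p : 0# ≤ k n ^ 2 * β/2 - w
        0≤p = ≤⇒0≤- (w≤k²β/2 n N≤n)
        0<p+k²β/2 : 0# < k n ^ 2 * β/2 - w + k n ^ 2 * β/2
        0<p+k²β/2 = <-≤-trans (*-pos (fromℕ²-pos n) 0<β/2) (≤-resp (+-identityˡ _) refl (+-mono-≤ 0≤p ≤-refl))
        inv : (k n ^ 2 * β/2 - w + k n ^ 2 * β/2) * - r n ≈ 1#
        inv = trans (*-congʳ (trans (solve 3 (λ K b w → K :* b :- w :+ K :* b :=
            K :* (b :+ b) :- w) refl (k n ^ 2) β/2 w)
                             (+-congʳ (*-congˡ (half+half β)))))
              (trans (solve 3 (λ K w r → (K :- w) :* :- r := (w :- K) :* r) refl (k n ^ 2 * β) w (r n)) (r-inverse n))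

    -- Reciprocal identities and partial fractions

    1/k-inverse : ∀ n → k n * 1/k n ≈ 1#
    1/k-inverse n = recip-inverseʳ (fromℕ#0 (suc n))

    1/2w 1/π² : ℝ
    1/2w = recip⁺ (*-pos 0<2 0<w)
    1/π² = recip⁺ (^-pos 2 0<π)

    α/π²≈1/β : α * 1/π² ≈ 1/β
    α/π²≈1/β = inverse-unique {x = β}
      (≈-modulo 1/π² αβ≈π² (≈-modulo 1# (recip⁺-inverseʳ (^-pos 2 0<π))
        (solve 4 (λ α β π q → β :* (α :* q) :=
            :1 :+ q :* (α :* β :- π :^ 2) :+ :1 :* (π :^ 2 :* q :- :1)) refl α β π 1/π²)))
      (recip⁺-inverseʳ 0<β)

    β/π²≈1/α : β * 1/π² ≈ 1/α
    β/π²≈1/α = inverse-unique {x = α}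
      (≈-modulo 1/π² αβ≈π² (≈-modulo 1# (recip⁺-inverseʳ (^-pos 2 0<π))
        (solve 4 (λ α β π q → α :* (β :* q) :=
            :1 :+ q :* (α :* β :- π :^ 2) :+ :1 :* (π :^ 2 :* q :- :1)) refl α β π 1/π²)))
      (recip⁺-inverseʳ 0<α)

    1/k*1/kα : ∀ n → 1/k n * 1/kα n ≈ 1/k² n * 1/α
    1/k*1/kα n = inverse-unique {x = k n ^ 2 * α}
      (≈-modulo 1# (recip⁺-inverseʳ (*-pos (k-pos n) 0<α)) (≈-modulo (k n * α * 1/kα n) (1/k-inverse n)
        (solve 4 (λ k α i j → k :^ 2 :* α :* (i :* j) :=
            :1 :+ :1 :* (k :* α :* j :- :1) :+ k :* α :* j :* (k :* i :- :1)) refl (k n) α (1/k n) (1/kα n))))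
      (≈-modulo 1# (recip⁺-inverseʳ 0<α) (≈-modulo (α * 1/α) (recip⁺-inverseʳ (fromℕ²-pos n))
        (solve 4 (λ K α i j → K :* α :* (i :* j) :=
            :1 :+ :1 :* (α :* j :- :1) :+ α :* j :* (K :* i :- :1)) refl (k n ^ 2) α (1/k² n) 1/α)))

    1/k*1/kβ : ∀ n → 1/k n * 1/kβ n ≈ 1/k² n * 1/β
    1/k*1/kβ n = inverse-unique {x = k n ^ 2 * β}
      (≈-modulo 1# (recip⁺-inverseʳ (*-pos (k-pos n) 0<β)) (≈-modulo (k n * β * 1/kβ n) (1/k-inverse n)
        (solve 4 (λ k α i j → k :^ 2 :* α :* (i :* j) :=
            :1 :+ :1 :* (k :* α :* j :- :1) :+ k :* α :* j :* (k :* i :- :1)) refl (k n) β (1/k n) (1/kβ n))))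
      (≈-modulo 1# (recip⁺-inverseʳ 0<β) (≈-modulo (β * 1/β) (recip⁺-inverseʳ (fromℕ²-pos n))
        (solve 4 (λ K α i j → K :* α :* (i :* j) :=
            :1 :+ :1 :* (α :* j :- :1) :+ α :* j :* (K :* i :- :1)) refl (k n ^ 2) β (1/k² n) 1/β)))

    -- The left side is the coefficient of coth(n α; A) b_n in F n + G n. Both of its terms have
    -- order 1/k, their difference has order 1/k³.
    ρ-partial-fraction : ∀ n → k n * α * ρ n - 1/k n ≈ - (w * ρ n * 1/k n)
    ρ-partial-fraction n = ≈-modulo (1/k n) (ρ-inverse n) (≈-modulo (- (k n * α * ρ n)) (1/k-inverse n)
      (solve 5 (λ w k α ρ i → k :* α :* ρ :- i :=
          :- (w :* ρ :* i) :+ i :* ((w :+ k :^ 2 :* α) :* ρ :- :1) :+ :- (k :* α :* ρ) :* (k :* i :- :1))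
        refl w (k n) α (ρ n) (1/k n)))

    r-partial-fraction : ∀ n → k n * β * r n + 1/k n ≈ w * r n * 1/k n
    r-partial-fraction n = ≈-modulo (- 1/k n) (r-inverse n) (≈-modulo (- (k n * β * r n)) (1/k-inverse n)
      (solve 5 (λ w k β r i → k :* β :* r :+ i :=
          w :* r :* i :+ :- i :* ((w :- k :^ 2 :* β) :* r :- :1) :+ :- (k :* β :* r) :* (k :* i :- :1))
        refl w (k n) β (r n) (1/k n)))

    -- Treats the part a₀/(n α) of coth(n α; A): its product with the merged coefficient splits into
    -- a term of the coth series at √(w β) and a term of D(2).
    ρ-recombine : ∀ n → - (w * ρ n * (1/k² n * 1/α)) ≈ ρ n - 1/α * 1/k² n
    ρ-recombine n = ≈-modulo (- (1/k² n * 1/α)) (ρ-inverse n)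
        (≈-modulo (α * 1/α * ρ n) (recip⁺-inverseʳ (fromℕ²-pos n)) (≈-modulo (ρ n) (recip⁺-inverseʳ 0<α)
      (solve 6 (λ w K α ρ κ j → :- (w :* ρ :* (κ :* j)) := ρ :- j :* κ :+ :- (κ :* j) :* ((w :+ K :* α) :* ρ :- :1)
                 :+ α :* j :* ρ :* (K :* κ :- :1) :+ ρ :* (α :* j :- :1))
        refl w (k n ^ 2) α (ρ n) (1/k² n) 1/α)))

    r-recombine : ∀ n → w * r n * (1/k² n * 1/β) ≈ r n + 1/β * 1/k² n
    r-recombine n = ≈-modulo (1/k² n * 1/β) (r-inverse n)
        (≈-modulo (β * 1/β * r n) (recip⁺-inverseʳ (fromℕ²-pos n)) (≈-modulo (r n) (recip⁺-inverseʳ 0<β)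
      (solve 6 (λ w K β r κ j → w :* r :* (κ :* j) := r :+ j :* κ :+ κ :* j :* ((w :- K :* β) :* r :- :1)
                 :+ β :* j :* r :* (K :* κ :- :1) :+ r :* (β :* j :- :1))
        refl w (k n ^ 2) β (r n) (1/k² n) 1/β)))

    h-partial-fraction : ∀ m n → r m * h m n ≈ ρ n * h m n + r m * ρ n
    h-partial-fraction m n = ≈-modulo (ρ n * h m n) (r-inverse m)
        (≈-modulo (- (r m * h m n)) (ρ-inverse n) (≈-modulo (r m * ρ n) (h-inverse m n)
      (solve 6 (λ w P Q r ρ h → r :* h := ρ :* h :+ r :* ρ :+ ρ :* h :* ((w :- P) :* r :- :1)
                 :+ :- (r :* h) :* ((w :+ Q) :* ρ :- :1) :+ r :* ρ :* ((P :+ Q) :* h :- :1))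
        refl w (k m ^ 2 * β) (k n ^ 2 * α) (r m) (ρ n) (h m n))))

    -- By α β = π², k² - w α/π² = (k² β - w)/β and k² + w β/π² = (k² α + w)/α. So `S⁻` is the series
    -- in cot(√(w α); A) up to the factor -β, and `S⁺` that in coth(√(w β); B) up to α.
    D S⁻ S⁺ : ∀ {x} → Admissible x → ℝ
    D  adm = proj₁ (series adm 1/k²-multiplier)
    S⁻ adm = proj₁ (series adm (proj₂ r-multiplier))
    S⁺ adm = proj₁ (series adm ρ-multiplier)

    -- Likewise k² + (n α/π)² = (k² β + n² α)/β, so coth(n α; A) weights the n-th column of `h` by
    -- A; with α and β exchanged, coth(n β; B) weights the n-th row by B.
    Cˡ Cʳ : ∀ {x} → Admissible x → ℕ → ℝ
    Cˡ adm n = proj₁ (series adm (h-multiplierˡ n))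
    Cʳ adm m = proj₁ (series adm (h-multiplierʳ m))

    cothα cothβ : ∀ {x} → ℝ → Admissible x → ℕ → ℝ
    cothα x₀ adm n = 1/kα n * x₀ + 2# * k n * Cˡ adm n
    cothβ x₀ adm n = 1/kβ n * x₀ + 2# * k n * Cʳ adm n

    -- In this form and in `Fᴿ`, `Gᴿ` every product pairs a quantity linear in A with one linear in
    -- B, so values at real and imaginary parts reassemble to the complex expressions.
    closedᴿ : ℝ → ℝ → ℝ → ℝ → ℝ
    closedᴿ a₀ b₀ da db = 1/2w * (a₀ * b₀) + 1/π² * (β * (a₀ * db) - α * (b₀ * da))

    Fᴿ Gᴿ : ℕ → ℝ → ℝ → ℝ → ℝ → ℝ
    Fᴿ n a b ca cb = ρ n * (k n * α * (ca * b)) + r n * (k n * β * (cb * a))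
    Gᴿ n a b ca cb = 1/k n * (a * cb - b * ca)

    -- This is 2 w (a₀/(2 w) + sa)(b₀/(2 w) + sb) multiplied out: (π/2) cot coth with the square
    -- roots, α and β eliminated.
    limitᴿ : ℝ → ℝ → ℝ → ℝ → ℝ
    limitᴿ a₀ b₀ sa sb = 1/2w * (a₀ * b₀) + a₀ * sb + b₀ * sa + 2# * w * (sa * sb)

    module _ {a b : ℕ → ℝ} (adm-a : Admissible a) (adm-b : Admissible b) where

      -- In the truncated square m, n < N the partial fraction expansion of r m * ρ n
      -- is exact; what is left are two tails.
      cross-term : ℕ → ℝ
      cross-term n = a n * r n * Cʳ adm-b n - b n * ρ n * Cˡ adm-a n

      -- Inner and outer sums run over the same range, so the exchange of summations is finite and
      -- involves no convergence.
      square : ∀ N → ∑₀ (λ m → a m * r m * ∑₀ (λ n → b n * h m n) N) N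
                   ≈ ∑₀ (λ n → b n * ρ n * ∑₀ (λ m → a m * h m n) N) N
                   + ∑₀ (λ n → a n * r n) N * ∑₀ (λ n → b n * ρ n) N
      square N = begin
        ∑₀ (λ m → a m * r m * ∑₀ (λ n → b n * h m n) N) N
          ≈⟨ ∑₀-cong (λ m → trans (sym (∑₀-scale (a m * r m) (λ n → b n * h m n) N))
               (trans (∑₀-cong (λ n → split m n) N) (∑₀-+ (λ n → b n * ρ n * (a m * h m n)) (λ n →
                   a m * r m * (b n * ρ n)) N))) N ⟩
        ∑₀ (λ m → ∑₀ (λ n → b n * ρ n * (a m * h m n)) N + ∑₀ (λ n → a m * r m * (b n * ρ n)) N) N
          ≈⟨ ∑₀-+ (λ m → ∑₀ (λ n → b n * ρ n * (a m * h m n)) N) (λ m → ∑₀ (λ n → a m * r m * (b n * ρ n)) N) N ⟩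
        ∑₀ (λ m → ∑₀ (λ n → b n * ρ n * (a m * h m n)) N) N + ∑₀ (λ m → ∑₀ (λ n → a m * r m * (b n * ρ n)) N) N
          ≈⟨ +-cong (trans (∑₀-swap (λ m n → b n * ρ n * (a m * h m n)) N N)
                           (∑₀-cong (λ n → ∑₀-scale (b n * ρ n) (λ m → a m * h m n) N) N))
                    (trans (∑₀-cong (λ m → trans (∑₀-scale (a m * r m) (λ n → b n * ρ n) N) (*-comm _ _)) N)
                           (trans (∑₀-scale (∑₀ (λ n → b n * ρ n) N) (λ m → a m * r m) N) (*-comm _ _))) ⟩
        ∑₀ (λ n → b n * ρ n * ∑₀ (λ m → a m * h m n) N) N + ∑₀ (λ n → a n * r n) N * ∑₀ (λ n → b n * ρ n) N ∎
        where
        open ≈-Reasoning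
        split : ∀ m n → a m * r m * (b n * h m n) ≈ b n * ρ n * (a m * h m n) + a m * r m * (b n * ρ n)
        split m n = ≈-modulo (a m * b n) (h-partial-fraction m n)
          (solve 5 (λ a b r ρ h → a :* r :* (b :* h) := b :* ρ :* (a :* h) :+ a :* r :* (b :* ρ)
                       :+ a :* b :* (r :* h :- (ρ :* h :+ r :* ρ))) refl (a m) (b n) (r m) (ρ n) (h m n))

      cross-sum : ∑₀ cross-term ⟶ᴿ S⁻ adm-a * S⁺ adm-b
      cross-sum = lim-cong (λ N → sym (decompose N))
        (solve 1 (λ x → :0 :+ :- :0 :+ x := x) refl (S⁻ adm-a * S⁺ adm-b))
        (lim-+ (lim-+ tailʳ⟶0 (lim-neg tailˡ⟶0))
               (lim-* {y = ∑₀ (λ n → b n * ρ n)} bounded (proj₁ (proj₂ (series adm-a (proj₂ r-multiplier))))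
                   (proj₁ (proj₂ (series adm-b ρ-multiplier)))))
        where
        CA CB : ℕ → ℕ → ℝ
        CA n = ∑₀ (λ m → a m * h m n)
        CB m = ∑₀ (λ n → b n * h m n)
        tailʳ tailˡ : ℕ → ℝ
        tailʳ N = ∑₀ (λ m → a m * r m * (Cʳ adm-b m - CB m N)) N
        tailˡ N = ∑₀ (λ n → b n * ρ n * (Cˡ adm-a n - CA n N)) N
        -- The constant 1/α of `h-multiplierʳ m` is the same for all m, so one remainder of B bounds
        -- every row's tail; for the columns the constant is 1/β.
        tailʳ⟶0 : tailʳ ⟶ᴿ 0#
        tailʳ⟶0 = ∑₀-*-remainder⟶0 adm-b adm-a (proj₂ r-multiplier) (λ m → proj₂
            (proj₂ (series adm-b (h-multiplierʳ m))))
        tailˡ⟶0 : tailˡ ⟶ᴿ 0#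
        tailˡ⟶0 = ∑₀-*-remainder⟶0 adm-a adm-b ρ-multiplier (λ n → proj₂ (proj₂ (series adm-a (h-multiplierˡ n))))
        bounded : ∀ N → ∑₀ (λ n → b n * ρ n) N ≼ total adm-b 1/α
        bounded N = ≼-≤-trans (∑₀-≼ (product≼majorant adm-b ρ-multiplier) N)
          (∑₀≤limit (λ n → ≼⇒0≤ (product≼majorant adm-b ρ-multiplier n)) (majorant-lim adm-b 1/α) N)
        distribute : ∀ (x y z : ℕ → ℝ) N → ∑₀ (λ n → x n * (y n - z n)) N
            ≈ ∑₀ (λ n → x n * y n) N - ∑₀ (λ n → x n * z n) N
        distribute x y z zero    = sym (-‿inverseʳ 0#)
        distribute x y z (suc N) = trans (+-congʳ (distribute x y z N))
          (solve 5 (λ Y Z x y z → Y :- Z :+ x :* (y :- z) := Y :+ x :* y :- (Z :+ x :* z)) refl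
            (∑₀ (λ n → x n * y n) N) (∑₀ (λ n → x n * z n) N) (x N) (y N) (z N))
        decompose : ∀ N → ∑₀ cross-term N ≈ tailʳ N - tailˡ N + ∑₀ (λ n → a n * r n) N * ∑₀ (λ n → b n * ρ n) N
        decompose N = trans (∑₀-minus (λ n → a n * r n * Cʳ adm-b n) (λ n → b n * ρ n * Cˡ adm-a n) N) (sym (trans
          (+-congʳ (+-cong (distribute (λ m → a m * r m) (Cʳ adm-b) (λ m → CB m N) N)
                           (-‿cong (distribute (λ n → b n * ρ n) (Cˡ adm-a) (λ n → CA n N) N))))
          (≈-modulo (- 1#) (square N)
            (solve 5 (λ X Y x y s → X :- x :- (Y :- y) :+ s := X :- Y :+ :- :1 :* (x :- (y :+ s))) refl
              (∑₀ (λ n → a n * r n * Cʳ adm-b n) N) (∑₀ (λ n → b n * ρ n * Cˡ adm-a n) N)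
              (∑₀ (λ m → a m * r m * CB m N) N) (∑₀ (λ n → b n * ρ n * CA n N) N)
              (∑₀ (λ n → a n * r n) N * ∑₀ (λ n → b n * ρ n) N)))))

      module _ (a₀ b₀ : ℝ) where

        ca cb : ℕ → ℝ
        ca = cothα a₀ adm-a
        cb = cothβ b₀ adm-b

        -- The part a₀/(n α) of coth yields the single series. In the part 2 n Σ_m a_m h_mn the
        -- factor n cancels the 1/n of the merged coefficient, which leaves one half of the cross
        -- term.
        b-summand : ∀ n → - (w * ρ n * 1/k n) * (ca n * b n)
            ≈ a₀ * (b n * ρ n + - 1/α * (b n * 1/k² n)) - 2# * w * (b n * ρ n * Cˡ adm-a n)
        b-summand n = ≈-modulo (- (w * ρ n * a₀ * b n)) (1/k*1/kα n)
            (≈-modulo (- (2# * w * ρ n * Cˡ adm-a n * b n)) (1/k-inverse n) (≈-modulo (a₀ * b n) (ρ-recombine n)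
          (solve 10 (λ w ρ i j K a₀ b C e κ → :- (w :* ρ :* i) :* ((j :* a₀ :+ :2 :* K :* C) :* b) :=
               a₀ :* (b :* ρ :+ :- e :* (b :* κ)) :- :2 :* w :* (b :* ρ :* C)
               :+ :- (w :* ρ :* a₀ :* b) :* (i :* j :- κ :* e) :+ :- (:2 :* w :* ρ :* C :* b) :* (K :* i :- :1)
               :+ a₀ :* b :* (:- (w :* ρ :* (κ :* e)) :- (ρ :- e :* κ)))
             refl w (ρ n) (1/k n) (1/kα n) (k n) a₀ (b n) (Cˡ adm-a n) 1/α (1/k² n))))

        a-summand : ∀ n → w * r n * 1/k n * (cb n * a n)
            ≈ b₀ * (a n * r n + 1/β * (a n * 1/k² n)) + 2# * w * (a n * r n * Cʳ adm-b n)
        a-summand n = ≈-modulo (w * r n * b₀ * a n) (1/k*1/kβ n)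
            (≈-modulo (2# * w * r n * Cʳ adm-b n * a n) (1/k-inverse n) (≈-modulo (b₀ * a n) (r-recombine n)
          (solve 10 (λ w ρ i j K a₀ b C e κ → w :* ρ :* i :* ((j :* a₀ :+ :2 :* K :* C) :* b) :=
               a₀ :* (b :* ρ :+ e :* (b :* κ)) :+ :2 :* w :* (b :* ρ :* C)
               :+ w :* ρ :* a₀ :* b :* (i :* j :- κ :* e) :+ :2 :* w :* ρ :* C :* b :* (K :* i :- :1)
               :+ a₀ :* b :* (w :* ρ :* (κ :* e) :- (ρ :+ e :* κ)))
             refl w (r n) (1/k n) (1/kβ n) (k n) b₀ (a n) (Cʳ adm-b n) 1/β (1/k² n))))

        single-b single-a : ℕ → ℝ
        single-b n = b n * ρ n + - 1/α * (b n * 1/k² n)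
        single-a n = a n * r n + 1/β * (a n * 1/k² n)

        summand : ∀ n → Fᴿ n (a n) (b n) (ca n) (cb n) + Gᴿ n (a n) (b n) (ca n) (cb n)
                      ≈ a₀ * single-b n + b₀ * single-a n + 2# * w * cross-term n
        summand n = begin
          Fᴿ n (a n) (b n) (ca n) (cb n) + Gᴿ n (a n) (b n) (ca n) (cb n)
            ≈⟨ solve 10 (λ ρ r i K α β a b ca cb → ρ :* (K :* α :* (ca :* b)) :+ r :* (K :* β :* (cb :* a))
                :+ i :* (a :* cb :- b :* ca) :=
                  (K :* α :* ρ :- i) :* (ca :* b) :+ (K :* β :* r :+ i) :* (cb :* a)) refl
                 (ρ n) (r n) (1/k n) (k n) α β (a n) (b n) (ca n) (cb n) ⟩
          (k n * α * ρ n - 1/k n) * (ca n * b n) + (k n * β * r n + 1/k n) * (cb n * a n)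
            ≈⟨ +-cong (*-congʳ (ρ-partial-fraction n)) (*-congʳ (r-partial-fraction n)) ⟩
          - (w * ρ n * 1/k n) * (ca n * b n) + w * r n * 1/k n * (cb n * a n)
            ≈⟨ +-cong (b-summand n) (a-summand n) ⟩
          a₀ * single-b n - 2# * w * (b n * ρ n * Cˡ adm-a n) + (b₀ * single-a n + 2# * w * (a n * r n * Cʳ adm-b n))
            ≈⟨ solve 5 (λ x y W p q → x :- W :* p :+ (y :+ W :* q) := x :+ y :+ W :* (q :- p)) refl
                 (a₀ * single-b n) (b₀ * single-a n) (2# * w) (b n * ρ n * Cˡ adm-a n) (a n * r n * Cʳ adm-b n) ⟩
          a₀ * single-b n + b₀ * single-a n + 2# * w * cross-term n ∎
          where open ≈-Reasoning

        sumF sumG partialᴿ : ℕ → ℝ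
        sumF = ∑₀ (λ n → Fᴿ n (a n) (b n) (ca n) (cb n))
        sumG = ∑₀ (λ n → Gᴿ n (a n) (b n) (ca n) (cb n))
        partialᴿ N = closedᴿ a₀ b₀ (D adm-a) (D adm-b) + sumF N + sumG N

        identityᴿ : partialᴿ ⟶ᴿ limitᴿ a₀ b₀ (S⁻ adm-a) (S⁺ adm-b)
        identityᴿ = lim-cong (λ N → sym (sums N)) value
          (lim-+ (lim-const {closedᴿ a₀ b₀ (D adm-a) (D adm-b)})
                 (lim-+ (lim-+ (lim-scale a₀ (combine (- 1/α) (limit adm-b ρ-multiplier)
                     (limit adm-b 1/k²-multiplier)))
                               (lim-scale b₀ (combine 1/β (limit adm-a
                                   (proj₂ r-multiplier)) (limit adm-a 1/k²-multiplier))))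
                        (lim-scale (2# * w) cross-sum)))
          where
          limit : ∀ {x y C} (adm : Admissible x) (y≼C : Multiplier y C) → ∑₀ (λ n →
              x n * y n) ⟶ᴿ proj₁ (series adm y≼C)
          limit adm y≼C = proj₁ (proj₂ (series adm y≼C))
          combine : ∀ {x y L M} c → ∑₀ x ⟶ᴿ L → ∑₀ y ⟶ᴿ M → ∑₀ (λ n → x n + c * y n) ⟶ᴿ L + c * M
          combine {x} {y} c x⟶L y⟶M = lim-cong
            (λ N → sym (trans (∑₀-+ x (λ n →
                c * y n) N) (+-congˡ (∑₀-scale c y N)))) refl (lim-+ x⟶L (lim-scale c y⟶M))
          sums : ∀ N → partialᴿ N
                     ≈ closedᴿ a₀ b₀ (D adm-a) (D adm-b) +
                         (a₀ * ∑₀ single-b N + b₀ * ∑₀ single-a N + 2# * w * ∑₀ cross-term N)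
          sums N = trans (+-assoc _ _ _) (+-congˡ (begin
            sumF N + sumG N
              ≈⟨ sym (∑₀-+ _ _ N) ⟩
            ∑₀ (λ n → Fᴿ n (a n) (b n) (ca n) (cb n) + Gᴿ n (a n) (b n) (ca n) (cb n)) N
              ≈⟨ ∑₀-cong summand N ⟩
            ∑₀ (λ n → a₀ * single-b n + b₀ * single-a n + 2# * w * cross-term n) N
              ≈⟨ ∑₀-+ _ _ N ⟩
            ∑₀ (λ n → a₀ * single-b n + b₀ * single-a n) N + ∑₀ (λ n → 2# * w * cross-term n) N
              ≈⟨ +-cong (trans (∑₀-+ _ _ N) (+-cong (∑₀-scale a₀ single-b N) (∑₀-scale b₀ single-a N))) (∑₀-scale
                  (2# * w) cross-term N) ⟩
            a₀ * ∑₀ single-b N + b₀ * ∑₀ single-a N + 2# * w * ∑₀ cross-term N ∎))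
            where open ≈-Reasoning
          value : closedᴿ a₀ b₀ (D adm-a) (D adm-b) + (a₀ * (S⁺ adm-b + - 1/α * D adm-b) + b₀ *
              (S⁻ adm-a + 1/β * D adm-a) + 2# * w * (S⁻ adm-a * S⁺ adm-b))
                  ≈ limitᴿ a₀ b₀ (S⁻ adm-a) (S⁺ adm-b)
          -- The D(2) terms cancel because α/π² = 1/β and β/π² = 1/α.
          value = ≈-modulo (- (b₀ * D adm-a)) α/π²≈1/β (≈-modulo (a₀ * D adm-b) β/π²≈1/α
            (solve 13 (λ a₀ b₀ da db sa sb W α β q e f w →
                W :* (a₀ :* b₀) :+ q :* (β :* (a₀ :* db) :- α :* (b₀ :* da)) :+ (a₀ :* (sb :+ :- e :* db)
                    :+ b₀ :* (sa :+ f :* da) :+ :2 :* w :* (sa :* sb))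
                := W :* (a₀ :* b₀) :+ a₀ :* sb :+ b₀ :* sa :+ :2 :* w :* (sa :* sb)
                    :+ :- (b₀ :* da) :* (α :* q :- f) :+ a₀ :* db :* (β :* q :- e))
              refl a₀ b₀ (D adm-a) (D adm-b) (S⁻ adm-a) (S⁺ adm-b) 1/2w α β 1/π² 1/α 1/β w))

    -- The identity for complex sequences

    scaled-sum : ∀ (x y z : ℕ → ℝ) c {L} → (∀ n → c * (x n * y n) ≈ x n * z n) →
                 ∑₀ (λ n → x n * y n) ⟶ᴿ L → ∑₀ (λ n → x n * z n) ⟶ᴿ c * L
    scaled-sum x y z c eq x⟶L = lim-cong
      (λ N → trans (sym (∑₀-scale c (λ n → x n * y n) N)) (∑₀-cong eq N)) refl (lim-scale c x⟶L)

    series-lim : ∀ {x y C} (adm : Admissible x) (y≼C : Multiplier y C) → ∑₀ (λ n →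
        x n * y n) ⟶ᴿ proj₁ (series adm y≼C)
    series-lim adm y≼C = proj₁ (proj₂ (series adm y≼C))

    open Cotangent π 0<π

    β/ππ≈1/α : β * (1/π * 1/π) ≈ 1/α
    β/ππ≈1/α = inverse-unique {x = α} (≈-modulo (1/π * 1/π) αβ≈π² (≈-modulo 1# π*1/π≈1 (≈-modulo (π * 1/π) π*1/π≈1
      (solve 4 (λ α β p q → α :* (β :* (q :* q)) :=
          :1 :+ q :* q :* (α :* β :- p :^ 2) :+ :1 :* (p :* q :- :1) :+ p :* q :* (p :* q :- :1)) refl α β π 1/π))))
      (recip⁺-inverseʳ 0<α)

    α/ππ≈1/β : α * (1/π * 1/π) ≈ 1/β
    α/ππ≈1/β = inverse-unique {x = β} (≈-modulo (1/π * 1/π) αβ≈π² (≈-modulo 1# π*1/π≈1 (≈-modulo (π * 1/π) π*1/π≈1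
      (solve 4 (λ α β p q → β :* (α :* (q :* q)) :=
          :1 :+ q :* q :* (α :* β :- p :^ 2) :+ :1 :* (p :* q :- :1) :+ p :* q :* (p :* q :- :1)) refl α β π 1/π))))
      (recip⁺-inverseʳ 0<β)

    -- s has the inverse s/x, so it is apart from 0, and 0 ≤ s leaves only the positive sign.
    sqrt-pos : ∀ {x s} → 0# < x → IsSqrt x s → 0# < s
    sqrt-pos {x} {s} 0<x (0≤s , ss≈x) with #⇒<⊎> (HCR.invertibleʳ⇒# {s} {0#} (s * recip⁺ 0<x , trans
        (*-congʳ (HCR.x-0≈x s))
      (trans (sym (*-assoc s s _)) (trans (*-congʳ ss≈x) (recip⁺-inverseʳ 0<x)))))
    ... | inj₁ s<0 = ⊥-elim (0≤s s<0)
    ... | inj₂ 0<s = 0<s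

    module Theorem (A B : ℤ → ℂ)
      (adm-reA : Admissible (λ n → re (A (ℤ.+ suc n)))) (adm-imA : Admissible (λ n → im (A (ℤ.+ suc n))))
      (adm-reB : Admissible (λ n → re (B (ℤ.+ suc n)))) (adm-imB : Admissible (λ n → im (B (ℤ.+ suc n))))
      (p q : ℝ) (√wα : IsSqrt (w * α) p) (√wβ : IsSqrt (w * β) q) where

      a₀ b₀ : ℂ
      a₀ = A (ℤ.+ 0)
      b₀ = B (ℤ.+ 0)

      0<p : 0# < p
      0<p = sqrt-pos (*-pos 0<w 0<α) √wα

      0<q : 0# < q
      0<q = sqrt-pos (*-pos 0<w 0<β) √wβ

      pp≈wα : p * p ≈ w * α
      pp≈wα = proj₂ √wα

      qq≈wβ : q * q ≈ w * β
      qq≈wβ = proj₂ √wβ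

      1/p 1/q : ℝ
      1/p = recip⁺ 0<p
      1/q = recip⁺ 0<q

      -- Both sides are positive with square w² α β = w² π². This ties the two given roots to π.
      pq≈wπ : p * q ≈ w * π
      pq≈wπ = ≤-antisym (square-cancel-≤ (<⇒≤ (*-pos 0<w 0<π)) (≤-reflexive squares))
                        (square-cancel-≤ (<⇒≤ (*-pos 0<p 0<q)) (≤-reflexive (sym squares)))
        where
        squares : p * q * (p * q) ≈ w * π * (w * π)
        squares = ≈-modulo (q * q) pp≈wα (≈-modulo (w * α) qq≈wβ (≈-modulo (w * w) αβ≈π²
          (solve 6 (λ p q w α β π → p :* q :* (p :* q) := w :* π :* (w :* π) :+ q :* q :* (p :* p :- w :* α)
             :+ w :* α :* (q :* q :- w :* β) :+ w :* w :* (α :* β :- π :^ 2)) refl p q w α β π)))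

      -- The coefficients 2 p/α and 2 q/β are 2 p β/π² and 2 q α/π², with the factors that relate
      -- `S⁻` and `S⁺` to the cotangent series absorbed.
      cotᴿ cothᴿ : ℝ → ℝ → ℝ
      cotᴿ x₀ s = 1/p * x₀ + 2# * p * 1/α * s
      cothᴿ x₀ s = 1/q * x₀ + 2# * q * 1/β * s

      πq≈pβ : π * q ≈ p * β
      πq≈pβ = *-cancelˡ-≈ 0<w (≈-modulo (- q) pq≈wπ (≈-modulo p qq≈wβ
        (solve 5 (λ p q w β π → w :* (π :* q) :=
            w :* (p :* β) :+ :- q :* (p :* q :- w :* π) :+ p :* (q :* q :- w :* β)) refl p q w β π)))

      πp≈qα : π * p ≈ q * α
      πp≈qα = *-cancelˡ-≈ 0<w (≈-modulo (- p) pq≈wπ (≈-modulo q pp≈wα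
        (solve 5 (λ p q w α π → w :* (π :* p) :=
            w :* (q :* α) :+ :- p :* (p :* q :- w :* π) :+ q :* (p :* p :- w :* α)) refl p q w α π)))

      1/2 : ℝ
      1/2 = recip⁺ 0<2

      -- Multiplied out, four coefficients remain: π/(2 p q) = 1/(2 w), π q/(p β) = 1, π p/(q α) = 1
      -- and 2 π p q/(α β) = 2 w. All rest on p q = w π.
      product-limitᴿ : ∀ x y s u → 1/2 * (π * (cotᴿ x s * cothᴿ y u)) ≈ limitᴿ x y s u
      product-limitᴿ x y s u = begin
        1/2 * (π * (cotᴿ x s * cothᴿ y u))
          ≈⟨ solve 12 (λ x y s u t π p p′ q q′ a b → t :* (π :* ((p′ :* x :+ :2 :* p :* a :* s) :* (q′ :* y
              :+ :2 :* q :* b :* u))) :=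
               t :* π :* p′ :* q′ :* (x :* y) :+ :2 :* t :* π :* q :* p′ :* b :* (x :* u)
                   :+ :2 :* t :* π :* p :* q′ :* a :* (y :* s)
               :+ :2 :* :2 :* t :* π :* p :* q :* a :* b :* (s :* u)) refl x y s u 1/2 π p 1/p q 1/q 1/α 1/β ⟩
        1/2 * π * 1/p * 1/q * (x * y) + 2# * 1/2 * π * q * 1/p * 1/β * (x * u) + 2# * 1/2 * π * p * 1/q * 1/α *
            (y * s)
          + 2# * 2# * 1/2 * π * p * q * 1/α * 1/β * (s * u)
          ≈⟨ +-cong (+-cong (+-cong (*-congʳ xy) (trans (*-congʳ xu) (*-identityˡ _)))
              (trans (*-congʳ ys) (*-identityˡ _))) (*-congʳ su) ⟩
        limitᴿ x y s u ∎
        where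
        open ≈-Reasoning
        2*1/2 : 2# * 1/2 ≈ 1#
        2*1/2 = recip⁺-inverseʳ 0<2
        xy : 1/2 * π * 1/p * 1/q ≈ 1/2w
        xy = inverse-unique {x = 2# * w}
          (≈-modulo (w * π * 1/p * 1/q) 2*1/2 (≈-modulo (- (1/p * 1/q)) pq≈wπ
              (≈-modulo (q * 1/q) (recip⁺-inverseʳ 0<p) (≈-modulo 1# (recip⁺-inverseʳ 0<q)
            (solve 7 (λ t w π p p′ q q′ → :2 :* w :* (t :* π :* p′ :* q′) :=
                :1 :+ w :* π :* p′ :* q′ :* (:2 :* t :- :1)
               :+ :- (p′ :* q′) :* (p :* q :- w :* π) :+ q :* q′ :* (p :* p′ :- :1)
                   :+ :1 :* (q :* q′ :- :1)) refl 1/2 w π p 1/p q 1/q)))))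
          (recip⁺-inverseʳ (*-pos 0<2 0<w))
        xu : 2# * 1/2 * π * q * 1/p * 1/β ≈ 1#
        xu = ≈-modulo (π * q * 1/p * 1/β) 2*1/2 (≈-modulo (1/p * 1/β) πq≈pβ
            (≈-modulo (β * 1/β) (recip⁺-inverseʳ 0<p) (≈-modulo 1# (recip⁺-inverseʳ 0<β)
          (solve 7 (λ t π p p′ q β b → :2 :* t :* π :* q :* p′ :* b := :1 :+ π :* q :* p′ :* b :* (:2 :* t :- :1)
             :+ p′ :* b :* (π :* q :- p :* β) :+ β :* b :* (p :* p′ :- :1)
                 :+ :1 :* (β :* b :- :1)) refl 1/2 π p 1/p q β 1/β))))
        ys : 2# * 1/2 * π * p * 1/q * 1/α ≈ 1#
        ys = ≈-modulo (π * p * 1/q * 1/α) 2*1/2 (≈-modulo (1/q * 1/α) πp≈qα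
            (≈-modulo (α * 1/α) (recip⁺-inverseʳ 0<q) (≈-modulo 1# (recip⁺-inverseʳ 0<α)
          (solve 7 (λ t π p p′ q β b → :2 :* t :* π :* q :* p′ :* b := :1 :+ π :* q :* p′ :* b :* (:2 :* t :- :1)
             :+ p′ :* b :* (π :* q :- p :* β) :+ β :* b :* (p :* p′ :- :1)
                 :+ :1 :* (β :* b :- :1)) refl 1/2 π q 1/q p α 1/α))))
        su : 2# * 2# * 1/2 * π * p * q * 1/α * 1/β ≈ 2# * w
        su = ≈-modulo (2# * π * p * q * 1/α * 1/β) 2*1/2 (≈-modulo (2# * π * 1/α * 1/β) pq≈wπ
            (≈-modulo (- (2# * w * 1/α * 1/β)) αβ≈π²
          (≈-modulo (2# * w * β * 1/β) (recip⁺-inverseʳ 0<α) (≈-modulo (2# * w) (recip⁺-inverseʳ 0<β)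
            (solve 9 (λ t w π p q α a β b → :2 :* :2 :* t :* π :* p :* q :* a :* b :=
                :2 :* w :+ :2 :* π :* p :* q :* a :* b :* (:2 :* t :- :1)
               :+ :2 :* π :* a :* b :* (p :* q :- w :* π) :+ :- (:2 :* w :* a :* b) :* (α :* β :- π :^ 2)
               :+ :2 :* w :* β :* b :* (α :* a :- :1) :+ :2 :* w :* (β :* b :- :1)) refl 1/2 w π p q α 1/α β 1/β)))))

      cot√wα coth√wβ DA2 DB2 : ℂ
      cot√wα = cotᴿ (re a₀) (S⁻ adm-reA) +i cotᴿ (im a₀) (S⁻ adm-imA)
      coth√wβ = cothᴿ (re b₀) (S⁺ adm-reB) +i cothᴿ (im b₀) (S⁺ adm-imB)
      DA2 = D adm-reA +i D adm-imA
      DB2 = D adm-reB +i D adm-imB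

      cothA cothB : ℕ → ℂ
      -- A filler: coth(0; A) is undefined, and the series run over positive n.
      cothA zero    = ι 0#
      cothA (suc n) = cothα (re a₀) adm-reA n +i cothα (im a₀) adm-imA n
      cothB zero    = ι 0#
      cothB (suc n) = cothβ (re b₀) adm-reB n +i cothβ (im b₀) adm-imB n

      isCot√wα : IsCot π A (ι p) cot√wα
      isCot√wα = isCot {S = (- β * S⁻ adm-reA) +i (- β * S⁻ adm-imA)} (recip⁺-inverseʳ 0<p) inv
        (sum adm-reA) (sum adm-imA) (value _ _) (value _ _)
        where
        inv : ∀ n → (k n ^ 2 - 1/π * p * (1/π * p)) * (- β * r n) ≈ 1#
        inv n = ≈-modulo (1/π * 1/π * β * r n) pp≈wα (≈-modulo (w * α * r n) β/ππ≈1/α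
            (≈-modulo (w * r n) (recip⁺-inverseʳ 0<α) (≈-modulo 1# (r-inverse n)
          (solve 8 (λ K i p β r w α a → (K :- i :* p :* (i :* p)) :* (:- β :* r) :=
              :1 :+ i :* i :* β :* r :* (p :* p :- w :* α)
             :+ w :* α :* r :* (β :* (i :* i) :- a) :+ w :* r :* (α :* a :- :1) :+ :1 :* ((w :- K :* β) :* r :- :1))
            refl (k n ^ 2) 1/π p β (r n) w α 1/α))))
        sum : ∀ {x} (adm : Admissible x) → ∑₀ (λ n → x n * (- β * r n)) ⟶ᴿ - β * S⁻ adm
        sum {x} adm = scaled-sum x r (λ n → - β * r n) (- β)
          (λ n → solve 3 (λ c x r → c :* (x :* r) :=
              x :* (c :* r)) refl (- β) (x n) (r n)) (series-lim adm (proj₂ r-multiplier))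
        value : ∀ x s → cotᴿ x s ≈ 1/p * x - 2# * (p * (1/π * 1/π)) * (- β * s)
        value x s = ≈-modulo (- (2# * p * s)) β/ππ≈1/α
          (solve 7 (λ x s p p′ a β i → p′ :* x :+ :2 :* p :* a :* s := p′ :* x :- :2 :* (p :* (i :* i)) :* (:- β :* s)
             :+ :- (:2 :* p :* s) :* (β :* (i :* i) :- a)) refl x s p 1/p 1/α β 1/π)

      isCoth√wβ : IsCoth π B (ι q) coth√wβ
      isCoth√wβ = isCoth {S = (α * S⁺ adm-reB) +i (α * S⁺ adm-imB)} (recip⁺-inverseʳ 0<q) inv
        (sum adm-reB) (sum adm-imB) (value _ _) (value _ _)
        where
        inv : ∀ n → (k n ^ 2 + 1/π * q * (1/π * q)) * (α * ρ n) ≈ 1#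
        inv n = ≈-modulo (1/π * 1/π * α * ρ n) qq≈wβ (≈-modulo (w * β * ρ n) α/ππ≈1/β
            (≈-modulo (w * ρ n) (recip⁺-inverseʳ 0<β) (≈-modulo 1# (ρ-inverse n)
          (solve 8 (λ K i q α ρ w β b → (K :+ i :* q :* (i :* q)) :* (α :* ρ) :=
              :1 :+ i :* i :* α :* ρ :* (q :* q :- w :* β)
             :+ w :* β :* ρ :* (α :* (i :* i) :- b) :+ w :* ρ :* (β :* b :- :1) :+ :1 :* ((w :+ K :* α) :* ρ :- :1))
            refl (k n ^ 2) 1/π q α (ρ n) w β 1/β))))
        sum : ∀ {x} (adm : Admissible x) → ∑₀ (λ n → x n * (α * ρ n)) ⟶ᴿ α * S⁺ adm
        sum {x} adm = scaled-sum x ρ (λ n → α * ρ n) α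
          (λ n → solve 3 (λ c x r → c :* (x :* r) := x :* (c :* r)) refl α (x n) (ρ n)) (series-lim adm ρ-multiplier)
        value : ∀ x s → cothᴿ x s ≈ 1/q * x + 2# * (q * (1/π * 1/π)) * (α * s)
        value x s = ≈-modulo (- (2# * q * s)) α/ππ≈1/β
          (solve 7 (λ x s q q′ b α i → q′ :* x :+ :2 :* q :* b :* s := q′ :* x :+ :2 :* (q :* (i :* i)) :* (α :* s)
             :+ :- (:2 :* q :* s) :* (α :* (i :* i) :- b)) refl x s q 1/q 1/β α 1/π)

      -- Shared by the two families coth(n α; A) and coth(n β; B), which differ by
      -- exchanging α and β.
      module _ {α β 1/α : ℝ} (αα′≈1 : α * 1/α ≈ 1#) (β/ππ≈1/α : β * (1/π * 1/π) ≈ 1/α) (n : ℕ) where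

        coth-inv : ∀ {K g} → (K * β + k n ^ 2 * α) * g ≈ 1# → (K + 1/π * (k n * α) * (1/π * (k n * α))) * (β * g) ≈ 1#
        coth-inv {K} {g} g-inv = ≈-modulo (k n ^ 2 * α * α * g) β/ππ≈1/α
            (≈-modulo (k n ^ 2 * α * g) αα′≈1 (≈-modulo 1# g-inv
          (solve 7 (λ K i k α β g a → (K :+ i :* (k :* α) :* (i :* (k :* α))) :* (β :* g) := :1
             :+ k :^ 2 :* α :* α :* g :* (β :* (i :* i) :- a) :+ k :^ 2 :* α :* g :* (α :* a :- :1)
             :+ :1 :* ((K :* β :+ k :^ 2 :* α) :* g :- :1)) refl K 1/π (k n) α β g 1/α)))

        coth-value : ∀ c x s → c * x + 2# * k n * s ≈ c * x + 2# * (k n * α * (1/π * 1/π)) * (β * s)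
        coth-value c x s = ≈-modulo (- (2# * k n * α * s)) β/ππ≈1/α (≈-modulo (- (2# * k n * s)) αα′≈1
          (solve 8 (λ c x s k α β i a → c :* x :+ :2 :* k :* s := c :* x :+ :2 :* (k :* α :* (i :* i)) :* (β :* s)
             :+ :- (:2 :* k :* α :* s) :* (β :* (i :* i) :- a)
                 :+ :- (:2 :* k :* s) :* (α :* a :- :1)) refl c x s (k n) α β 1/π 1/α))

      isCothA : ∀ n → IsCoth π A (ι (k n * α)) (cothA (suc n))
      isCothA n = isCoth {S = (β * Cˡ adm-reA n) +i (β * Cˡ adm-imA n)} (recip⁺-inverseʳ (*-pos (k-pos n) 0<α))
        (λ m → coth-inv (recip⁺-inverseʳ 0<α) β/ππ≈1/α n (h-inverse m n))
        (sum adm-reA) (sum adm-imA)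
        (coth-value (recip⁺-inverseʳ 0<α) β/ππ≈1/α n _ _ _) (coth-value (recip⁺-inverseʳ 0<α) β/ππ≈1/α n _ _ _)
        where
        sum : ∀ {x} (adm : Admissible x) → ∑₀ (λ m → x m * (β * h m n)) ⟶ᴿ β * Cˡ adm n
        sum {x} adm = scaled-sum x (λ m → h m n) (λ m → β * h m n) β
          (λ m → solve 3 (λ c x r → c :* (x :* r) :=
              x :* (c :* r)) refl β (x m) (h m n)) (series-lim adm (h-multiplierˡ n))

      isCothB : ∀ n → IsCoth π B (ι (k n * β)) (cothB (suc n))
      isCothB n = isCoth {S = (α * Cʳ adm-reB n) +i (α * Cʳ adm-imB n)} (recip⁺-inverseʳ (*-pos (k-pos n) 0<β))
        (λ m → coth-inv (recip⁺-inverseʳ 0<β) α/ππ≈1/β n (trans (*-congʳ (+-comm _ _)) (h-inverse n m)))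
        (sum adm-reB) (sum adm-imB)
        (coth-value (recip⁺-inverseʳ 0<β) α/ππ≈1/β n _ _ _) (coth-value (recip⁺-inverseʳ 0<β) α/ππ≈1/β n _ _ _)
        where
        sum : ∀ {x} (adm : Admissible x) → ∑₀ (λ m → x m * (α * h n m)) ⟶ᴿ α * Cʳ adm n
        sum {x} adm = scaled-sum x (h n) (λ m → α * h n m) α
          (λ m → solve 3 (λ c x r → c :* (x :* r) :=
              x :* (c :* r)) refl α (x m) (h n m)) (series-lim adm (h-multiplierʳ n))

      isDirichletA : IsDirichlet A 2 DA2
      isDirichletA = component-sum (λ n → *-comm _ _) (λ n → *-comm _ _)
        (series-lim adm-reA 1/k²-multiplier) (series-lim adm-imA 1/k²-multiplier)

      isDirichletB : IsDirichlet B 2 DB2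
      isDirichletB = component-sum (λ n → *-comm _ _) (λ n → *-comm _ _)
        (series-lim adm-reB 1/k²-multiplier) (series-lim adm-imB 1/k²-multiplier)

      lhs closed : ℂ
      lhs = (π · (cot√wα *ᶜ coth√wβ)) / 2# [ 0<⇒#0 0<2 ]
      closed = (a₀ *ᶜ b₀) / (2# * w) [ 0<⇒#0 (*-pos 0<2 0<w) ]
               +ᶜ (β · (a₀ *ᶜ DB2) -ᶜ α · (b₀ *ᶜ DA2)) / (π ^ 2) [ 0<⇒#0 (^-pos 2 0<π) ]

      F G : Terms
      F n = ((fromℕ n * α) · (cothA n *ᶜ B (ℤ.+ n))) / (w + fromℕ n ^ 2 * α) [ 0<⇒#0 (+-pos 0<w
          (*-pos (^-pos 2 (0<fromℕ n)) 0<α)) ]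
            +ᶜ ((fromℕ n * β) · (cothB n *ᶜ A (ℤ.+ n))) / (w - fromℕ n ^ 2 * β) [ #⇒-#0 (w#n²β n) ]
      G n = (A (ℤ.+ n) *ᶜ cothB n -ᶜ B (ℤ.+ n) *ᶜ cothA n) / fromℕ n [ fromℕ#0 n ]

      -- Real and imaginary parts of the two sides

      re-closed : re closed ≈ closedᴿ (re a₀) (re b₀) (re DA2) (re DB2) - closedᴿ (im a₀) (im b₀) (im DA2) (im DB2)
      re-closed = solve 12 (λ W q α β a a′ b b′ da da′ db db′ →
          W :* (a :* b :- a′ :* b′) :+ q :* (β :* (a :* db :- a′ :* db′) :- α :* (b :* da :- b′ :* da′)) :=
          W :* (a :* b) :+ q :* (β :* (a :* db) :- α :* (b :* da)) :- (W :* (a′ :* b′)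
              :+ q :* (β :* (a′ :* db′) :- α :* (b′ :* da′))))
        refl 1/2w 1/π² α β (re a₀) (im a₀) (re b₀) (im b₀) (re DA2) (im DA2) (re DB2) (im DB2)

      im-closed : im closed ≈ closedᴿ (re a₀) (im b₀) (re DA2) (im DB2) + closedᴿ (im a₀) (re b₀) (im DA2) (re DB2)
      im-closed = solve 12 (λ W q α β a a′ b b′ da da′ db db′ →
          W :* (a :* b′ :+ a′ :* b) :+ q :* (β :* (a :* db′ :+ a′ :* db) :- α :* (b :* da′ :+ b′ :* da)) :=
          W :* (a :* b′) :+ q :* (β :* (a :* db′) :- α :* (b′ :* da)) :+ (W :* (a′ :* b)
              :+ q :* (β :* (a′ :* db) :- α :* (b :* da′))))
        refl 1/2w 1/π² α β (re a₀) (im a₀) (re b₀) (im b₀) (re DA2) (im DA2) (re DB2) (im DB2)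

      re-F : ∀ n → re (F (suc n)) ≈ Fᴿ n (re (A (ℤ.+ suc n))) (re (B (ℤ.+ suc n))) (re (cothA (suc n))) (re (cothB
          (suc n)))
                          - Fᴿ n (im (A (ℤ.+ suc n))) (im (B (ℤ.+ suc n))) (im (cothA (suc n))) (im (cothB (suc n)))
      re-F n = solve 13 (λ ρ r K α β a a′ b b′ u u′ v v′ →
          ρ :* (K :* α :* (u :* b :- u′ :* b′)) :+ r :* (K :* β :* (v :* a :- v′ :* a′)) :=
          ρ :* (K :* α :* (u :* b)) :+ r :* (K :* β :* (v :* a)) :- (ρ :* (K :* α :* (u′ :* b′))
              :+ r :* (K :* β :* (v′ :* a′))))
        refl (ρ n) (r n) (k n) α β (re (A (ℤ.+ suc n))) (im (A (ℤ.+ suc n))) (re (B (ℤ.+ suc n))) (im (B (ℤ.+ suc n)))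
           (re (cothA (suc n))) (im (cothA (suc n))) (re (cothB (suc n))) (im (cothB (suc n)))

      re-G : ∀ n → re (G (suc n)) ≈ Gᴿ n (re (A (ℤ.+ suc n))) (re (B (ℤ.+ suc n))) (re (cothA (suc n))) (re (cothB
          (suc n)))
                          - Gᴿ n (im (A (ℤ.+ suc n))) (im (B (ℤ.+ suc n))) (im (cothA (suc n))) (im (cothB (suc n)))
      re-G n = solve 9 (λ i a a′ b b′ u u′ v v′ →
          i :* ((a :* v :- a′ :* v′) :- (b :* u :- b′ :* u′)) :=
              i :* (a :* v :- b :* u) :- i :* (a′ :* v′ :- b′ :* u′))
        refl (1/k n) (re (A (ℤ.+ suc n))) (im (A (ℤ.+ suc n))) (re (B (ℤ.+ suc n))) (im (B (ℤ.+ suc n)))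
           (re (cothA (suc n))) (im (cothA (suc n))) (re (cothB (suc n))) (im (cothB (suc n)))

      im-F : ∀ n → im (F (suc n)) ≈ Fᴿ n (re (A (ℤ.+ suc n))) (im (B (ℤ.+ suc n))) (re (cothA (suc n))) (im (cothB
          (suc n)))
                          + Fᴿ n (im (A (ℤ.+ suc n))) (re (B (ℤ.+ suc n))) (im (cothA (suc n))) (re (cothB (suc n)))
      im-F n = solve 13 (λ ρ r K α β a a′ b b′ u u′ v v′ →
          ρ :* (K :* α :* (u :* b′ :+ u′ :* b)) :+ r :* (K :* β :* (v :* a′ :+ v′ :* a)) :=
          ρ :* (K :* α :* (u :* b′)) :+ r :* (K :* β :* (v′ :* a)) :+ (ρ :* (K :* α :* (u′ :* b))
              :+ r :* (K :* β :* (v :* a′))))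
        refl (ρ n) (r n) (k n) α β (re (A (ℤ.+ suc n))) (im (A (ℤ.+ suc n))) (re (B (ℤ.+ suc n))) (im (B (ℤ.+ suc n)))
           (re (cothA (suc n))) (im (cothA (suc n))) (re (cothB (suc n))) (im (cothB (suc n)))

      im-G : ∀ n → im (G (suc n)) ≈ Gᴿ n (re (A (ℤ.+ suc n))) (im (B (ℤ.+ suc n))) (re (cothA (suc n))) (im (cothB
          (suc n)))
                          + Gᴿ n (im (A (ℤ.+ suc n))) (re (B (ℤ.+ suc n))) (im (cothA (suc n))) (re (cothB (suc n)))
      im-G n = solve 9 (λ i a a′ b b′ u u′ v v′ →
          i :* ((a :* v′ :+ a′ :* v) :- (b :* u′ :+ b′ :* u)) :=
              i :* (a :* v′ :- b′ :* u) :+ i :* (a′ :* v :- b :* u′))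
        refl (1/k n) (re (A (ℤ.+ suc n))) (im (A (ℤ.+ suc n))) (re (B (ℤ.+ suc n))) (im (B (ℤ.+ suc n)))
           (re (cothA (suc n))) (im (cothA (suc n))) (re (cothB (suc n))) (im (cothB (suc n)))

      partial-sum : ℕ → ℂ
      partial-sum N = closed +ᶜ ∑ F N +ᶜ ∑ G N

      -- The real part is the real identity at (re A, re B) minus that at (im A, im B); the
      -- imaginary part is the sum of those at the two mixed pairs.
      partial-sum⟶lhs : partial-sum ⟶ lhs
      partial-sum⟶lhs = component-lim
        (lim-cong (λ N → sym (begin
            re closed + re (∑ F N) + re (∑ G N)
              ≈⟨ +-cong (+-cong re-closed (trans (re-∑ F re-F N) (∑₀-minus _ _ N)))
                  (trans (re-∑ G re-G N) (∑₀-minus _ _ N)) ⟩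
            _ ≈⟨ solve 6 (λ c c′ f f′ g g′ → c :- c′ :+ (f :- f′) :+ (g :- g′) :=
                c :+ f :+ g :- (c′ :+ f′ :+ g′)) refl _ _ _ _ _ _ ⟩
            partialᴿ adm-reA adm-reB (re a₀) (re b₀) N - partialᴿ adm-imA adm-imB (im a₀) (im b₀) N ∎))
          (sym (trans
            (solve 4 (λ t π x y → t :* (π :* (x :- y)) := t :* (π :* x) :- t :* (π :* y)) refl
              1/2 π (re cot√wα * re coth√wβ) (im cot√wα * im coth√wβ))
            (+-cong (product-limitᴿ _ _ _ _) (-‿cong (product-limitᴿ _ _ _ _)))))
          (lim-+ (identityᴿ adm-reA adm-reB (re a₀) (re b₀)) (lim-neg (identityᴿ adm-imA adm-imB (im a₀) (im b₀)))))
        (lim-cong (λ N → sym (begin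
            im closed + im (∑ F N) + im (∑ G N)
              ≈⟨ +-cong (+-cong im-closed (trans (im-∑ F im-F N) (∑₀-+ _ _ N))) (trans (im-∑ G im-G N) (∑₀-+ _ _ N)) ⟩
            _ ≈⟨ solve 6 (λ c c′ f f′ g g′ → c :+ c′ :+ (f :+ f′) :+ (g :+ g′) :=
                c :+ f :+ g :+ (c′ :+ f′ :+ g′)) refl _ _ _ _ _ _ ⟩
            partialᴿ adm-reA adm-imB (re a₀) (im b₀) N + partialᴿ adm-imA adm-reB (im a₀) (re b₀) N ∎))
          (sym (trans
            (solve 4 (λ t π x y → t :* (π :* (x :+ y)) := t :* (π :* x) :+ t :* (π :* y)) refl
              1/2 π (re cot√wα * im coth√wβ) (im cot√wα * re coth√wβ))
            (+-cong (product-limitᴿ _ _ _ _) (product-limitᴿ _ _ _ _))))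
          (lim-+ (identityᴿ adm-reA adm-imB (re a₀) (im b₀)) (identityᴿ adm-imA adm-reB (im a₀) (re b₀))))
        where open ≈-Reasoning

      -- If both series converge, the joint partial sums also tend to `closed +ᶜ S +ᶜ T`, and limits
      -- are unique.
      lhs≈sum : ∀ S T → HasSum F S → HasSum G T → lhs ≈ᶜ closed +ᶜ S +ᶜ T
      lhs≈sum S T F⟶S G⟶T =
        lim-unique (re-lim partial-sum⟶lhs) (lim-+ (lim-+ (lim-const {re closed}) (re-lim F⟶S)) (re-lim G⟶T)) ,
        lim-unique (im-lim partial-sum⟶lhs) (lim-+ (lim-+ (lim-const {im closed}) (im-lim F⟶S)) (im-lim G⟶T))

theorem5p7 : ∀ {c ℓ₁ ℓ₂} (𝓡 : CompleteOrderedField c ℓ₁ ℓ₂) → let open Analysis 𝓡 in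
  (A B : ℤ → ℂ) →
  (∃[ e ] e < 1# × A isℴ e) →
  (∃[ e ] e < 1# × B isℴ e) →
  (π α β w : ℝ) (isπ : IsPi π) (0<α : 0# < α) (0<β : 0# < β) →
  α * β ≈ π ^ 2 →
  (0<w : 0# < w) →
  (w#n²β : ∀ n .{{_ : NonZero n}} → w # fromℕ n ^ 2 * β) →
  (√wα √wβ : ℝ) → IsSqrt (w * α) √wα → IsSqrt (w * β) √wβ →
  ∃[ cot√wα ] ∃[ coth√wβ ] Σ[ cothA ∈ (ℕ → ℂ) ] Σ[ cothB ∈ (ℕ → ℂ) ] ∃[ DA2 ] ∃[ DB2 ]
    IsCot π A (ι √wα) cot√wα ×
    IsCoth π B (ι √wβ) coth√wβ ×
    (∀ (n : ℕ) .{{_ : NonZero n}} → IsCoth π A (ι (fromℕ n * α)) (cothA n)) ×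
    (∀ (n : ℕ) .{{_ : NonZero n}} → IsCoth π B (ι (fromℕ n * β)) (cothB n)) ×
    IsDirichlet A 2 DA2 ×
    IsDirichlet B 2 DB2 ×
    (let
      a : ℕ → ℂ
      a n = A (ℤ.+ n)
      b : ℕ → ℂ
      b n = B (ℤ.+ n)
      lhs : ℂ
      lhs = (π · (cot√wα *ᶜ coth√wβ)) / 2# [ 0<⇒#0 0<2 ]
      closed : ℂ
      closed = (a 0 *ᶜ b 0) / (2# * w) [ 0<⇒#0 (*-pos 0<2 0<w) ]
             +ᶜ (β · (a 0 *ᶜ DB2) -ᶜ α · (b 0 *ᶜ DA2)) / (π ^ 2) [ 0<⇒#0 (^-pos 2 (IsPi.0<π isπ)) ]
      F : Terms
      F n = ((fromℕ n * α) · (cothA n *ᶜ b n)) / (w + fromℕ n ^ 2 * α) [ 0<⇒#0 (+-pos 0<w (*-pos (^-pos 2 (0<fromℕ n)) 0<α)) ]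
          +ᶜ ((fromℕ n * β) · (cothB n *ᶜ a n)) / (w - fromℕ n ^ 2 * β) [ #⇒-#0 (w#n²β n) ]
      G : Terms
      G n = (a n *ᶜ cothB n -ᶜ b n *ᶜ cothA n) / fromℕ n [ fromℕ#0 n ]
    in
      ((λ N → closed +ᶜ ∑ F N +ᶜ ∑ G N) ⟶ lhs) ×
      (∀ S T → HasSum F S → HasSum G T → lhs ≈ᶜ closed +ᶜ S +ᶜ T))
theorem5p7 𝓡 A B (_ , d<1 , Aℴ) (_ , e<1 , Bℴ) π α β w isπ 0<α 0<β αβ≈π² 0<w w#n²β p q √wα √wβ =
  cot√wα , coth√wβ , cothA , cothB , DA2 , DB2 ,
  isCot√wα , isCoth√wβ , nonZero-cases isCothA , nonZero-cases isCothB , isDirichletA , isDirichletB ,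
  partial-sum⟶lhs , lhs≈sum
  where
  open Analysis 𝓡
  open Proof 𝓡
  open Setting π α β w (IsPi.0<π isπ) 0<α 0<β αβ≈π² 0<w w#n²β
  open Theorem A B
    (isℴ⇒admissible re ∣∣≤⇒re≼ d<1 Aℴ) (isℴ⇒admissible im ∣∣≤⇒im≼ d<1 Aℴ)
    (isℴ⇒admissible re ∣∣≤⇒re≼ e<1 Bℴ) (isℴ⇒admissible im ∣∣≤⇒im≼ e<1 Bℴ)
    p q √wα √wβ
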